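{- Let $C$ be a co-c.e.\ cohesive set. Then there is a computable copy $\mathcal{L} = (\mathbb{N}, \prec_\mathcal{L})$ of $\omega$ and a computable coloring $F \colon \mathbb{N} \rightarrow \mathbb{N}$ of $\mathcal{L}$ with the following property. Let $[\varphi]$ and $[\psi]$ be any two non-standard elements of $\Pi_C \mathcal{L}$ with $[\psi] \prec_{\Pi_C \mathcal{L}} [\varphi]$. Then for every solid color $[\delta]_{\mathrm{col}}$, there is a $[\theta]$ in $\Pi_C \mathcal{L}$ with $[\psi] \prec_{\Pi_C \mathcal{L}} [\theta] \prec_{\Pi_C \mathcal{L}} [\varphi]$ and $\widehat{F}([\theta]) = [\delta]_{\mathrm{col}}$. Also, there is a $[\theta]$ in $\Pi_C \mathcal{L}$ with $[\psi] \prec_{\Pi_C \mathcal{L}} [\theta] \prec_{\Pi_C \mathcal{L}} [\varphi]$, where $\widehat{F}([\theta])$ is a striped color.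
   Context: A set $C \subseteq \mathbb{N}$ is cohesive if it is infinite and for every c.e.\ set $W$, either $C \subseteq^* W$ or $C \subseteq^* \overline{W}$ ($X \subseteq^* Y$ means $X \setminus Y$ is finite). For a computable linear order $\mathcal{L}$ with domain $L$, the cohesive power $\Pi_C \mathcal{L}$ has as elements the classes $[\varphi]$ of partial computable $\varphi \colon \mathbb{N} \rightarrow L$ with $C \subseteq^* \mathrm{dom}(\varphi)$, modulo $\varphi =_C \psi$ iff $C \subseteq^* \{x : \varphi(x){\downarrow} = \psi(x){\downarrow}\}$; and $[\varphi] \prec_{\Pi_C \mathcal{L}} [\psi]$ iff $C \subseteq^* \{x : \varphi(x){\downarrow}, \psi(x){\downarrow}, \varphi(x) \prec_\mathcal{L} \psi(x)\}$. For $\mathcal{L}$ of type $\omega$, the standard elements of $\Pi_C \mathcal{L}$ are those represented by constant functions (the image of the canonical embedding, an initial segment of type $\omega$); the others are non-standard (equivalently, $\lim_{n \in C}\varphi(n) = \infty$). A coloring $F \colon \mathbb{N} \rightarrow \mathbb{N}$ of $\mathcal{L}$ induces a coloring $\widehat{F}$ of $\Pi_C \mathcal{L}$: colors of $\Pi_C \mathcal{L}$ are the $=_C$-equivalence classes, written $[\delta]_{\mathrm{col}}$, of partial computable functions $\delta \colon \mathbb{N} \rightarrow \mathbb{N}$ with $C \subseteq^* \mathrm{dom}(\delta)$, and $\widehat{F}([\varphi]) = [F \circ \varphi]_{\mathrm{col}}$. A color $[\delta]_{\mathrm{col}}$ is solid if there is an $x \in \mathbb{N}$ with $\delta(n) =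 x$ for almost every $n \in C$; otherwise it is striped (then $\lim_{n \in C}\delta(n) = \infty$). -}

module Defs where

open import Data.Nat using (ℕ; zero; suc; _≤_; _<_)
open import Data.Bool using (Bool; true; false)
open import Data.Fin using (Fin)
open import Data.Vec using (Vec; []; _∷_; lookup)
open import Data.Maybe using (Maybe; just; nothing; _>>=_)
open import Data.Product using (Σ; ∃; _×_; _,_)
open import Relation.Nullary using (¬_)
open import Relation.Binary.PropositionalEquality using (_≡_)
open import Function.Bundles using (_⇔_)
open import Function.Definitions using (Bijective)

data PR : ℕ → Set where
  zer  : ∀ {n} → PR n
  succ : PR 1
  proj : ∀ {n} → Fin n → PR n
  comp : ∀ {n m} → PR m → Vec (PR n) m → PR n
  prec : ∀ {n} → PR n → PR (suc (suc n)) → PR (suc n)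
  mu   : ∀ {n} → PR (suc n) → PR n

mutual
  eval : ℕ → ∀ {n} → PR n → Vec ℕ n → Maybe ℕ
  eval zero    _          _ = nothing
  eval (suc s) zer        v = just 0
  eval (suc s) succ       (x ∷ []) = just (suc x)
  eval (suc s) (proj i)   v = just (lookup v i)
  eval (suc s) (comp f gs) v = evalVec s gs v >>= λ w → eval s f w
  eval (suc s) (prec f g) (x ∷ v) = evalRec s f g x v
  eval (suc s) (mu f)     v = search s f s 0 v

  evalVec : ℕ → ∀ {n m} → Vec (PR n) m → Vec ℕ n → Maybe (Vec ℕ m)
  evalVec s []       v = just []
  evalVec s (g ∷ gs) v = eval s g v >>= λ y → evalVec s gs v >>= λ ys → just (y ∷ ys)

  evalRec : ℕ → ∀ {n} → PR n → PR (suc (suc n)) → ℕ → Vec ℕ n → Maybe ℕ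
  evalRec s f g zero    v = eval s f v
  evalRec s f g (suc k) v = evalRec s f g k v >>= λ r → eval s g (k ∷ r ∷ v)

  search : ℕ → ∀ {n} → PR (suc n) → ℕ → ℕ → Vec ℕ n → Maybe ℕ
  search s f zero       k v = nothing
  search s f (suc b)    k v = eval s f (k ∷ v) >>= λ
    { zero    → just k
    ; (suc _) → search s f b (suc k) v }

_⟨_⟩≃_ : PR 1 → ℕ → ℕ → Set
e ⟨ x ⟩≃ y = ∃ λ s → eval s e (x ∷ []) ≡ just y

_⟨_⟩↓ : PR 1 → ℕ → Set
e ⟨ x ⟩↓ = ∃ λ y → e ⟨ x ⟩≃ y

Computable : (ℕ → ℕ) → Set
Computable F = ∃ λ (e : PR 1) → ∀ x → ∃ λ s → eval s e (x ∷ []) ≡ just (F x)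

boolToℕ : Bool → ℕ
boolToℕ false = 0
boolToℕ true  = 1

Computable₂ : (ℕ → ℕ → Bool) → Set
Computable₂ R = ∃ λ (e : PR 2) →
  ∀ x y → ∃ λ s → eval s e (x ∷ y ∷ []) ≡ just (boolToℕ (R x y))

_⊆*_ : (ℕ → Set) → (ℕ → Set) → Set
X ⊆* Y = ∃ λ m → ∀ n → m ≤ n → X n → Y n

Infinite : (ℕ → Set) → Set
Infinite X = ∀ m → ∃ λ n → m ≤ n × X n

W : PR 1 → ℕ → Set
W e x = e ⟨ x ⟩↓

Cohesive : (ℕ → Set) → Set
Cohesive C = Infinite C ×
  (∀ (e : PR 1) → (C ⊆* W e) ⊎' (C ⊆* (λ x → ¬ W e x)))
  where open import Data.Sum renaming (_⊎_ to _⊎'_)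

CoCE : (ℕ → Set) → Set
CoCE C = ∃ λ (e : PR 1) → ∀ n → (¬ C n) ⇔ W e n

OmegaType : (ℕ → ℕ → Bool) → Set
OmegaType lt = ∃ λ (h : ℕ → ℕ) → Bijective _≡_ _≡_ h ×
  (∀ x y → (lt x y ≡ true) ⇔ (h x < h y))

-- Cohesive power Π_C L (elements represented by codes of partial
-- computable functions)

module _ (C : ℕ → Set) where

  InPower : PR 1 → Set
  InPower φ = C ⊆* W φ

  EqC : PR 1 → PR 1 → Set
  EqC φ ψ = C ⊆* (λ x → ∃ λ y → φ ⟨ x ⟩≃ y × ψ ⟨ x ⟩≃ y)

  LessC : (ℕ → ℕ → Bool) → PR 1 → PR 1 → Set
  LessC lt φ ψ = C ⊆* (λ x → ∃ λ a → ∃ λ b →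
    φ ⟨ x ⟩≃ a × ψ ⟨ x ⟩≃ b × lt a b ≡ true)

  Standard : PR 1 → Set
  Standard φ = ∃ λ c → C ⊆* (λ x → φ ⟨ x ⟩≃ c)

  NonStandard : PR 1 → Set
  NonStandard φ = ¬ Standard φ

  IsColor : PR 1 → Set
  IsColor δ = C ⊆* W δ

  ColorOf : (ℕ → ℕ) → PR 1 → PR 1 → Set
  ColorOf F θ δ = C ⊆* (λ x → ∃ λ y → θ ⟨ x ⟩≃ y × δ ⟨ x ⟩≃ F y)

  Solid : PR 1 → Set
  Solid δ = ∃ λ c → C ⊆* (λ x → δ ⟨ x ⟩≃ c)

  Striped : PR 1 → Set
  Striped δ = ¬ Solid δ

{-# OPTIONS --safe #-}
module Submission where

-- Let D be the set of numbers that never leave C in the given enumeration of the complement of C;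
-- classically D = C.  The order L is a sum of finite blocks, indexed by their maxima ("roots") in the
-- natural order.  A new label x goes on top of everything, or is inserted immediately below an older
-- label b in the block of b.  Block t aims at separating, for every color d ≤ t, all its labels up to the
-- k-th element of D from each other by an element of color d, where k = t + (number of labels in earlier
-- blocks).  Approximating D from above, each of the finitely many requests below that bound is served
-- finitely often, so the blocks are finite and L has type ω.
--
-- No diagonalisation against all pairs φ, ψ is needed: the sparsity of C suffices.  A computable function
-- tending to infinity along C is eventually injective on C, and every computable function eventually maps
-- n ∈ C below the next element of C; both follow from cohesiveness applied to the c.e. sets of the form
-- {n : all j < B(n) with R(n, j) have left C}.  If t is large, then among the first k elements of C more
-- than (number of labels in earlier blocks) are large, so by pigeonhole φ sends one of them, n, into a
-- block ≥ t; as ψ(n) and φ(n) do not exceed the k-th element of C, every color ≤ t separates them.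
-- Hence the c.e. set of n with a suitable element between ψ(n) and φ(n) meets C infinitely often, and by
-- cohesiveness it contains almost all of C.  For a striped color, ask for the color at n to be the block
-- index of φ(n).

open import Defs
open import Data.Nat
open import Data.Nat.Properties
open import Data.Nat.Induction using (<-rec)
open import Data.Nat.Tactic.RingSolver using (solve-∀)
open import Data.Bool using (Bool; true; false; if_then_else_; not; _∧_; _∨_)
open import Data.Bool.Properties using (T-≡; ¬-not)
open import Data.Empty using (⊥; ⊥-elim)
open import Data.Fin using (Fin; zero; suc)
open import Data.Maybe using (Maybe; just; nothing; _>>=_)
open import Data.Maybe.Properties using (just-injective)
open import Data.Product using (Σ; ∃; _×_; _,_; proj₁; proj₂)
open import Data.Sum using (_⊎_; inj₁; inj₂)
open import Data.Vec using (Vec; []; _∷_; lookup; tail; tabulate)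
open import Data.Vec.Properties using (tabulate∘lookup)
open import Function.Bundles using (Equivalence; mk⇔)
open import Relation.Binary.Definitions using (tri<; tri≈; tri>)
open import Relation.Binary.PropositionalEquality
open import Relation.Nullary using (¬_; yes; no; contradiction)

-- Computable functions

_⟦_⟧≃_ : ∀ {n} → PR n → Vec ℕ n → ℕ → Set
e ⟦ v ⟧≃ y = ∃ λ s → eval s e v ≡ just y

>>=-just : ∀ {A B : Set} (m : Maybe A) {k : A → Maybe B} {y} → (m >>= k) ≡ just y →
  ∃ λ x → m ≡ just x × k x ≡ just y
>>=-just (just x) eq = x , refl , eq

mutual
  eval-mono : ∀ {s s′ n} (e : PR n) {v y} → s ≤ s′ → eval s e v ≡ just y → eval s′ e v ≡ just y
  eval-mono zer {v} (s≤s le) eq = eq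
  eval-mono succ {x ∷ []} (s≤s le) eq = eq
  eval-mono (proj i) (s≤s le) eq = eq
  eval-mono (comp f gs) {v} (s≤s {s} le) eq
    with w , eq₁ , eq₂ ← >>=-just (evalVec s gs v) eq
    rewrite evalVec-mono gs le eq₁ = eval-mono f le eq₂
  eval-mono (prec f g) {x ∷ v} (s≤s le) eq = evalRec-mono f g x le eq
  eval-mono (mu f) (s≤s le) eq = search-mono f le le eq

  evalVec-mono : ∀ {s s′ n m} (gs : Vec (PR n) m) {v w} → s ≤ s′ →
    evalVec s gs v ≡ just w → evalVec s′ gs v ≡ just w
  evalVec-mono [] le eq = eq
  evalVec-mono {s} (g ∷ gs) {v} le eq
    with y , eq₁ , eq₂ ← >>=-just (eval s g v) eq
    with ys , eq₃ , eq₄ ← >>=-just (evalVec s gs v) eq₂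
    rewrite eval-mono g le eq₁ | evalVec-mono gs le eq₃ = eq₄

  evalRec-mono : ∀ {s s′ n} (f : PR n) (g : PR (suc (suc n))) x {v y} → s ≤ s′ →
    evalRec s f g x v ≡ just y → evalRec s′ f g x v ≡ just y
  evalRec-mono f g zero le eq = eval-mono f le eq
  evalRec-mono {s} f g (suc x) {v} le eq
    with r , eq₁ , eq₂ ← >>=-just (evalRec s f g x v) eq
    rewrite evalRec-mono f g x le eq₁ = eval-mono g le eq₂

  search-mono : ∀ {s s′ n} (f : PR (suc n)) {b b′ k v y} → s ≤ s′ → b ≤ b′ →
    search s f b k v ≡ just y → search s′ f b′ k v ≡ just y
  search-mono {s} f {k = k} {v} le (s≤s lb) eq with eval s f (k ∷ v) in eq₁
  ... | just zero    rewrite eval-mono f le eq₁ = eq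
  ... | just (suc _) rewrite eval-mono f le eq₁ = search-mono f le lb eq

⟦⟧-functional : ∀ {n} (e : PR n) {v y z} → e ⟦ v ⟧≃ y → e ⟦ v ⟧≃ z → y ≡ z
⟦⟧-functional e (s , p) (s′ , q) =
  just-injective (trans (sym (eval-mono e (m≤m⊔n s s′) p)) (eval-mono e (m≤n⊔m s s′) q))

record Comp {n} (f : Vec ℕ n → ℕ) : Set where
  constructor mkComp
  field
    code : PR n
    runs : ∀ v → code ⟦ v ⟧≃ f v
open Comp

record CompVec {n m} (g : Vec ℕ n → Vec ℕ m) : Set where
  constructor mkCompVec
  field
    codes : Vec (PR n) m
    runs  : ∀ v → ∃ λ s → evalVec s codes v ≡ just (g v)
open CompVec

ext : ∀ {n} {f g : Vec ℕ n → ℕ} → Comp f → (∀ v → f v ≡ g v) → Comp g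
ext c eq .code = code c
ext c eq .runs v = subst (code c ⟦ v ⟧≃_) (eq v) (runs c v)

extVec : ∀ {n m} {f g : Vec ℕ n → Vec ℕ m} → CompVec f → (∀ v → f v ≡ g v) → CompVec g
extVec c eq .codes = codes c
extVec c eq .runs v = subst (λ w → ∃ λ s → evalVec s (codes c) v ≡ just w) (eq v) (runs c v)

var : ∀ {n} (i : Fin n) → Comp (λ v → lookup v i)
var i .code = proj i
var i .runs v = 1 , refl

[]ᶜ : ∀ {n} → CompVec {n} (λ _ → [])
[]ᶜ .codes = []
[]ᶜ .runs v = 0 , refl

infixr 5 _∷ᶜ_
_∷ᶜ_ : ∀ {n m} {f : Vec ℕ n → ℕ} {g : Vec ℕ n → Vec ℕ m} →
  Comp f → CompVec g → CompVec (λ v → f v ∷ g v)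
(c ∷ᶜ d) .codes = code c ∷ codes d
(_∷ᶜ_ {f = f} {g} c d) .runs v = s ⊔ s′ , eq
  where
  s = proj₁ (runs c v)
  s′ = proj₁ (runs d v)
  eq : evalVec (s ⊔ s′) (code c ∷ codes d) v ≡ just (f v ∷ g v)
  eq rewrite eval-mono (code c) (m≤m⊔n s s′) (proj₂ (runs c v))
           | evalVec-mono (codes d) (m≤n⊔m s s′) (proj₂ (runs d v)) = refl

_∘ᶜ_ : ∀ {n m} {f : Vec ℕ m → ℕ} {g : Vec ℕ n → Vec ℕ m} →
  Comp f → CompVec g → Comp (λ v → f (g v))
(c ∘ᶜ d) .code = comp (code c) (codes d)
(_∘ᶜ_ {f = f} {g} c d) .runs v = suc (s ⊔ s′) , eq
  where
  s = proj₁ (runs c (g v))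
  s′ = proj₁ (runs d v)
  eq : eval (suc (s ⊔ s′)) (comp (code c) (codes d)) v ≡ just (f (g v))
  eq rewrite evalVec-mono (codes d) (m≤n⊔m s s′) (proj₂ (runs d v))
    = eval-mono (code c) (m≤m⊔n s s′) (proj₂ (runs c (g v)))

renaming′ : ∀ {n m} (ρ : Fin m → Fin n) → CompVec (λ v → tabulate (λ i → lookup v (ρ i)))
renaming′ {m = zero}  ρ = []ᶜ
renaming′ {m = suc m} ρ = var (ρ zero) ∷ᶜ renaming′ (λ i → ρ (suc i))

idᶜ : ∀ {n} → CompVec {n} (λ v → v)
idᶜ = extVec (renaming′ (λ i → i)) tabulate∘lookup

tail²ᶜ : ∀ {n} → CompVec {suc (suc n)} (λ v → tail (tail v))
tail²ᶜ = extVec (renaming′ (λ i → suc (suc i))) λ { (x ∷ y ∷ v) → tabulate∘lookup v }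

sucᶜ : ∀ {n} {f : Vec ℕ n → ℕ} → Comp f → Comp (λ v → suc (f v))
sucᶜ c = mkComp {f = λ w → suc (lookup w zero)} succ (λ { (x ∷ []) → 1 , refl }) ∘ᶜ (c ∷ᶜ []ᶜ)

constᶜ : ∀ {n} k → Comp {n} (λ _ → k)
constᶜ zero    = mkComp zer λ v → 1 , refl
constᶜ (suc k) = sucᶜ (constᶜ k)

primrec : ∀ {n} → (Vec ℕ n → ℕ) → (Vec ℕ (suc (suc n)) → ℕ) → ℕ → Vec ℕ n → ℕ
primrec f g zero    v = f v
primrec f g (suc k) v = g (k ∷ primrec f g k v ∷ v)

module _ {n} {f : Vec ℕ n → ℕ} {g : Vec ℕ (suc (suc n)) → ℕ} (cf : Comp f) (cg : Comp g) where

  evalRec-primrec : ∀ k v → ∃ λ s → evalRec s (code cf) (code cg) k v ≡ just (primrec f g k v)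
  evalRec-primrec zero v = runs cf v
  evalRec-primrec (suc k) v = s ⊔ s′ , eq
    where
    r = primrec f g k v
    s = proj₁ (evalRec-primrec k v)
    s′ = proj₁ (runs cg (k ∷ r ∷ v))
    eq : evalRec (s ⊔ s′) (code cf) (code cg) (suc k) v ≡ just (g (k ∷ r ∷ v))
    eq rewrite evalRec-mono (code cf) (code cg) k (m≤m⊔n s s′) (proj₂ (evalRec-primrec k v))
      = eval-mono (code cg) (m≤n⊔m s s′) (proj₂ (runs cg (k ∷ r ∷ v)))

  primrec₀ᶜ : Comp (λ w → primrec f g (lookup w zero) (tail w))
  primrec₀ᶜ .code = prec (code cf) (code cg)
  primrec₀ᶜ .runs (k ∷ v) = let s , eq = evalRec-primrec k v in suc s , eq

  primrecᶜ : {a : Vec ℕ n → ℕ} → Comp a → Comp (λ v → primrec f g (a v) v)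
  primrecᶜ ca = primrec₀ᶜ ∘ᶜ (ca ∷ᶜ idᶜ)

module _ {n} {f : Vec ℕ (suc n) → ℕ} (cf : Comp f) (v : Vec ℕ n) where

  search-sound : ∀ s b k {y} → search s (code cf) b k v ≡ just y → f (y ∷ v) ≡ 0
  search-sound s (suc b) k eq with eval s (code cf) (k ∷ v) in eq₁
  search-sound s (suc b) k refl | just zero =
    ⟦⟧-functional (code cf) (runs cf (k ∷ v)) (s , eq₁)
  ... | just (suc _) = search-sound s b (suc k) eq

  mu-sound : ∀ {y} → mu (code cf) ⟦ v ⟧≃ y → f (y ∷ v) ≡ 0
  mu-sound (suc s , eq) = search-sound s s 0 eq

  -- Induction on the distance `j` from the starting point `k` to a known zero. The search may stop
  -- at an earlier zero, so its result `y` stays existential.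
  search-complete : ∀ j k → f (j + k ∷ v) ≡ 0 → ∃ λ s → ∃ λ b → ∃ λ y →
    search s (code cf) b k v ≡ just y
  search-complete j k fj≡0 with f (k ∷ v) in eq | runs cf (k ∷ v)
  search-complete j k fj≡0 | zero | s , r = s , 1 , k , lem
    where
    lem : search s (code cf) 1 k v ≡ just k
    lem rewrite r = refl
  search-complete zero k fj≡0 | suc x | s , r with () ← trans (sym eq) fj≡0
  search-complete (suc j) k fj≡0 | suc x | s , r
    with s′ , b , y , h ← search-complete j (suc k) (subst (λ i → f (i ∷ v) ≡ 0) (sym (+-suc j k)) fj≡0)
    = s ⊔ s′ , suc b , y , lem
    where
    lem : search (s ⊔ s′) (code cf) (suc b) k v ≡ just y
    lem rewrite eval-mono (code cf) (m≤m⊔n s s′) r =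
      search-mono (code cf) {b = b} {k = suc k} {v = v} (m≤n⊔m s s′) ≤-refl h

  mu-complete : ∀ j → f (j ∷ v) ≡ 0 → ∃ λ y → mu (code cf) ⟦ v ⟧≃ y
  mu-complete j fj≡0
    with s , b , y , h ← search-complete j 0 (subst (λ i → f (i ∷ v) ≡ 0) (sym (+-identityʳ j)) fj≡0)
    = y , suc (s ⊔ b) , search-mono (code cf) (m≤m⊔n s b) (m≤n⊔m s b) h

minimiseᶜ : ∀ {n} {f : Vec ℕ (suc n) → ℕ} → Comp f → (∀ v → ∃ λ j → f (j ∷ v) ≡ 0) →
  ∃ λ (g : Vec ℕ n → ℕ) → Comp g × (∀ v → f (g v ∷ v) ≡ 0)
minimiseᶜ {f = f} cf total = (λ v → proj₁ (least v)) , mkComp (mu (code cf)) (λ v → proj₂ (least v)) ,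
  λ v → mu-sound cf v (proj₂ (least v))
  where
  least : ∀ v → ∃ λ y → mu (code cf) ⟦ v ⟧≃ y
  least v = mu-complete cf v (proj₁ (total v)) (proj₂ (total v))

-- Computable arithmetic, tests and bounded quantifiers

x₀ : ∀ {n} → Comp {1 + n} (λ v → lookup v zero)
x₀ = var zero
x₁ : ∀ {n} → Comp {2 + n} (λ v → lookup v (suc zero))
x₁ = var (suc zero)
x₂ : ∀ {n} → Comp {3 + n} (λ v → lookup v (suc (suc zero)))
x₂ = var (suc (suc zero))
record CompB {n} (p : Vec ℕ n → Bool) : Set where
  constructor mkCompB
  field toComp : Comp (λ v → boolToℕ (p v))
open CompB

module _ {n} {f : Vec ℕ n → ℕ} where

  weaken² : Comp f → Comp (λ w → f (tail (tail w)))
  weaken² c = c ∘ᶜ tail²ᶜ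

  predᶜ : Comp f → Comp (λ v → pred (f v))
  predᶜ c = ext (primrecᶜ (constᶜ 0) x₀ c) λ v → lem v (f v)
    where
    lem : ∀ (v : Vec ℕ n) k → primrec (λ _ → 0) (λ w → lookup w zero) k v ≡ pred k
    lem v zero = refl
    lem v (suc k) = refl

module _ {n} {f g : Vec ℕ n → ℕ} (cf : Comp f) (cg : Comp g) where

  infixl 10 _+ᶜ_ _∸ᶜ_

  _+ᶜ_ : Comp (λ v → f v + g v)
  _+ᶜ_ = ext (primrecᶜ cg (sucᶜ x₁) cf) λ v → lem v (f v)
    where
    lem : ∀ v k → primrec g (λ w → suc (lookup w (suc zero))) k v ≡ k + g v
    lem v zero = refl
    lem v (suc k) = cong suc (lem v k)

  _∸ᶜ_ : Comp (λ v → f v ∸ g v)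
  _∸ᶜ_ = ext (primrecᶜ cf (predᶜ x₁) cg) λ v → lem v (g v)
    where
    lem : ∀ v k → primrec f (λ w → pred (lookup w (suc zero))) k v ≡ f v ∸ k
    lem v zero = refl
    lem v (suc k) = trans (cong pred (lem v k)) (pred[m∸n]≡m∸[1+n] (f v) k)

module _ {n} {f g : Vec ℕ n → ℕ} (cf : Comp f) (cg : Comp g) where

  infixl 11 _*ᶜ_
  _*ᶜ_ : Comp (λ v → f v * g v)
  _*ᶜ_ = ext (primrecᶜ (constᶜ 0) (weaken² cg +ᶜ x₁) cf) λ v → lem v (f v)
    where
    lem : ∀ v k → primrec (λ _ → 0) (λ w → g (tail (tail w)) + lookup w (suc zero)) k v ≡ k * g v
    lem v zero = refl
    lem v (suc k) = cong (g v +_) (lem v k)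

2^ᶜ : ∀ {n} {f : Vec ℕ n → ℕ} → Comp f → Comp (λ v → 2 ^ f v)
2^ᶜ {n} {f} c = ext (primrecᶜ (constᶜ 1) (constᶜ 2 *ᶜ x₁) c) λ v → lem v (f v)
  where
  lem : ∀ (v : Vec ℕ n) k → primrec (λ _ → 1) (λ w → 2 * lookup w (suc zero)) k v ≡ 2 ^ k
  lem v zero = refl
  lem v (suc k) = cong (2 *_) (lem v k)

ifᶜ : ∀ {n} {p : Vec ℕ n → Bool} {f g : Vec ℕ n → ℕ} → CompB p → Comp f → Comp g →
  Comp (λ v → if p v then f v else g v)
ifᶜ {n} {p} {f} {g} cp cf cg = ext (primrecᶜ cg (weaken² cf) (toComp cp)) λ v → lem v (p v)
  where
  lem : ∀ v b → primrec g (λ w → f (tail (tail w))) (boolToℕ b) v ≡ (if b then f v else g v)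
  lem v false = refl
  lem v true = refl

ifᵇᶜ : ∀ {n} {p q r : Vec ℕ n → Bool} → CompB p → CompB q → CompB r →
  CompB (λ v → if p v then q v else r v)
ifᵇᶜ {p = p} {q} {r} cp cq cr .toComp =
  ext (ifᶜ cp (toComp cq) (toComp cr)) λ v → lem (p v) (q v) (r v)
  where
  lem : ∀ a b c → (if a then boolToℕ b else boolToℕ c) ≡ boolToℕ (if a then b else c)
  lem false b c = refl
  lem true b c = refl

extB : ∀ {n} {p q : Vec ℕ n → Bool} → CompB p → (∀ v → p v ≡ q v) → CompB q
extB c eq .toComp = ext (toComp c) λ v → cong boolToℕ (eq v)

_∘ᵇᶜ_ : ∀ {n m} {p : Vec ℕ m → Bool} {g : Vec ℕ n → Vec ℕ m} →
  CompB p → CompVec g → CompB (λ v → p (g v))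
(c ∘ᵇᶜ d) .toComp = toComp c ∘ᶜ d

trueᶜ : ∀ {n} → CompB {n} (λ _ → true)
trueᶜ .toComp = constᶜ 1

falseᶜ : ∀ {n} → CompB {n} (λ _ → false)
falseᶜ .toComp = constᶜ 0

notᶜ : ∀ {n} {p : Vec ℕ n → Bool} → CompB p → CompB (λ v → not (p v))
notᶜ {p = p} c = extB (ifᵇᶜ c falseᶜ trueᶜ) λ v → lem (p v)
  where
  lem : ∀ b → (if b then false else true) ≡ not b
  lem false = refl
  lem true = refl

-- Records rather than abbreviations, so that the function can be inferred from its computability proof.
record Comp₁ (f : ℕ → ℕ) : Set where
  constructor mkComp₁
  field toComp₁ : Comp {1} (λ v → f (lookup v zero))
open Comp₁

record CompRel (R : ℕ → ℕ → Bool) : Set where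
  constructor mkCompRel
  field toCompB : CompB {2} (λ v → R (lookup v zero) (lookup v (suc zero)))
open CompRel

infixl 12 _·_
_·_ : ∀ {f} → Comp₁ f → ∀ {n} {g : Vec ℕ n → ℕ} → Comp g → Comp (λ v → f (g v))
c · d = toComp₁ c ∘ᶜ (d ∷ᶜ []ᶜ)

on₂ : ∀ {R} → CompRel R → ∀ {n} {f g : Vec ℕ n → ℕ} → Comp f → Comp g → CompB (λ v → R (f v) (g v))
on₂ c d e = toCompB c ∘ᵇᶜ (d ∷ᶜ e ∷ᶜ []ᶜ)

infixr 6 _∧ᶜ_
_∧ᶜ_ : ∀ {n} {p q : Vec ℕ n → Bool} → CompB p → CompB q → CompB (λ v → p v ∧ q v)
_∧ᶜ_ {p = p} {q} c d = extB (ifᵇᶜ c d falseᶜ) λ v → lem (p v) (q v)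
  where
  lem : ∀ a b → (if a then b else false) ≡ a ∧ b
  lem false b = refl
  lem true b = refl

infixr 5 _∨ᶜ_
_∨ᶜ_ : ∀ {n} {p q : Vec ℕ n → Bool} → CompB p → CompB q → CompB (λ v → p v ∨ q v)
_∨ᶜ_ {p = p} {q} c d = extB (ifᵇᶜ c trueᶜ d) λ v → lem (p v) (q v)
  where
  lem : ∀ a b → (if a then true else b) ≡ a ∨ b
  lem false b = refl
  lem true b = refl

infix 8 _<ᶜ_ _≡ᶜ_
_<ᶜ_ : ∀ {n} {f g : Vec ℕ n → ℕ} → Comp f → Comp g → CompB (λ v → f v <ᵇ g v)
_<ᶜ_ {f = f} {g} c d .toComp =
  -- Truncated subtraction from 1 and then from 2 reduces `d ∸ c` to its sign, which is 1 exactly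
  -- when `f v < g v`.
  ext (predᶜ (constᶜ 2 ∸ᶜ (constᶜ 1 ∸ᶜ (d ∸ᶜ c)))) λ v → lem (f v) (g v)
  where
  lem : ∀ a b → pred (2 ∸ (1 ∸ (b ∸ a))) ≡ boolToℕ (a <ᵇ b)
  lem zero zero = refl
  lem zero (suc b) rewrite 0∸n≡0 b = refl
  lem (suc a) zero = refl
  lem (suc a) (suc b) = lem a b

_≡ᶜ_ : ∀ {n} {f g : Vec ℕ n → ℕ} → Comp f → Comp g → CompB (λ v → f v ≡ᵇ g v)
_≡ᶜ_ {f = f} {g} c d = extB (notᶜ (c <ᶜ d) ∧ᶜ notᶜ (d <ᶜ c)) λ v → lem (f v) (g v)
  where
  lem : ∀ a b → (not (a <ᵇ b) ∧ not (b <ᵇ a)) ≡ (a ≡ᵇ b)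
  lem zero zero = refl
  lem zero (suc b) = refl
  lem (suc a) zero = refl
  lem (suc a) (suc b) = lem a b

∑< : ℕ → (ℕ → ℕ) → ℕ
∑< zero    f = 0
∑< (suc n) f = ∑< n f + f n

#< : ℕ → (ℕ → Bool) → ℕ
#< n p = ∑< n (λ j → boolToℕ (p j))

all< : ℕ → (ℕ → Bool) → Bool
all< zero    p = true
all< (suc n) p = all< n p ∧ p n

∑<ᶜ : ∀ {n} {f : Vec ℕ (suc n) → ℕ} {a : Vec ℕ n → ℕ} → Comp a → Comp f →
  Comp (λ v → ∑< (a v) (λ j → f (j ∷ v)))
∑<ᶜ {n} {f} {a} ca cf =
  ext (primrecᶜ (constᶜ 0) (x₁ +ᶜ (cf ∘ᶜ (x₀ ∷ᶜ tail²ᶜ))) ca) λ v → lem v (a v)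
  where
  lem : ∀ v k → primrec (λ _ → 0) (λ w → lookup w (suc zero) + f (lookup w zero ∷ tail (tail w))) k v
    ≡ ∑< k (λ j → f (j ∷ v))
  lem v zero = refl
  lem v (suc k) = cong (_+ f (k ∷ v)) (lem v k)

#<ᶜ : ∀ {n} {p : Vec ℕ (suc n) → Bool} {a : Vec ℕ n → ℕ} → Comp a → CompB p →
  Comp (λ v → #< (a v) (λ j → p (j ∷ v)))
#<ᶜ ca cp = ∑<ᶜ ca (toComp cp)

all<ᶜ : ∀ {n} {p : Vec ℕ (suc n) → Bool} {a : Vec ℕ n → ℕ} → Comp a → CompB p →
  CompB (λ v → all< (a v) (λ j → p (j ∷ v)))
all<ᶜ {n} {p} {a} ca cp .toComp =
  ext (primrecᶜ (constᶜ 1) (x₁ *ᶜ toComp (cp ∘ᵇᶜ (x₀ ∷ᶜ tail²ᶜ))) ca) λ v → lem v (a v)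
  where
  boolToℕ-∧ : ∀ b c → boolToℕ b * boolToℕ c ≡ boolToℕ (b ∧ c)
  boolToℕ-∧ false c = refl
  boolToℕ-∧ true false = refl
  boolToℕ-∧ true true = refl
  lem : ∀ v k → primrec (λ _ → 1)
    (λ w → lookup w (suc zero) * boolToℕ (p (lookup w zero ∷ tail (tail w)))) k v
    ≡ boolToℕ (all< k (λ j → p (j ∷ v)))
  lem v zero = refl
  lem v (suc k) = trans (cong (_* boolToℕ (p (k ∷ v))) (lem v k))
    (boolToℕ-∧ (all< k (λ j → p (j ∷ v))) (p (k ∷ v)))

-- Step-indexed evaluation of a fixed code is computable

encode : Maybe ℕ → ℕ
encode nothing  = 0
encode (just y) = suc y

Clocked : ∀ {n} → (ℕ → Vec ℕ n → Maybe ℕ) → Set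
Clocked r = Comp (λ w → encode (r (lookup w zero) (tail w)))

-- A case distinction on the fuel, written as a primitive recursion that ignores its recursive
-- value.
clock-suc : ∀ {n} (r : ℕ → Vec ℕ n → Maybe ℕ) → (∀ v → r 0 v ≡ nothing) →
  Clocked (λ s → r (suc s)) → Clocked r
clock-suc r r₀ c = ext (primrec₀ᶜ (constᶜ 0) (c ∘ᶜ (x₀ ∷ᶜ tail²ᶜ)))
  λ { (zero ∷ v) → cong encode (sym (r₀ v)) ; (suc s ∷ v) → refl }

-- `evalVec` is split into a vector of values, with default 0 for a diverging component, and the
-- flag `defined`.
values : ∀ {n m} → Vec (PR n) m → ℕ → Vec ℕ n → Vec ℕ m
values []       s v = []
values (g ∷ gs) s v = pred (encode (eval s g v)) ∷ values gs s v

defined : ∀ {n m} → Vec (PR n) m → ℕ → Vec ℕ n → Bool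
defined []       s v = true
defined (g ∷ gs) s v = (0 <ᵇ encode (eval s g v)) ∧ defined gs s v

evalVec-defined : ∀ {n m} (gs : Vec (PR n) m) s v →
  evalVec s gs v ≡ (if defined gs s v then just (values gs s v) else nothing)
evalVec-defined []       s v = refl
evalVec-defined (g ∷ gs) s v with eval s g v
... | nothing = refl
... | just y rewrite evalVec-defined gs s v with defined gs s v
...   | false = refl
...   | true  = refl

module _ {n} (f : PR (suc n)) (s : ℕ) (v : Vec ℕ n) where

  probe : ℕ → ℕ → ℕ
  probe k c = if 0 <ᵇ c then (if c ≡ᵇ 1 then 2 + k else 1) else 0

  -- 0: some probe diverged; 1: no zero found yet; 2 + k: the zero k was found.
  searchState : ℕ → ℕ
  searchState zero    = 1
  searchState (suc k) =
    if searchState k ≡ᵇ 1 then probe k (encode (eval s f (k ∷ v))) else searchState k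

  searchState-stable : ∀ k {y} → searchState k ≡ y → (y ≡ᵇ 1) ≡ false → ∀ b → searchState (k + b) ≡ y
  searchState-stable k {y} eq y≢1 zero rewrite +-identityʳ k = eq
  searchState-stable k {y} eq y≢1 (suc b)
    rewrite +-suc k b | searchState-stable k eq y≢1 b | y≢1 = refl

  -- `pred` sends the states 0 and 1 to `encode nothing` and the state `2 + k` to `encode (just k)`:
  -- a diverging probe and an exhausted bound both count as failure. A state other than 1 is final,
  -- by `searchState-stable`.
  search-searchState : ∀ b k → searchState k ≡ 1 →
    pred (searchState (k + b)) ≡ encode (search s f b k v)
  search-searchState zero k eq rewrite +-identityʳ k | eq = refl
  search-searchState (suc b) k eq rewrite +-suc k b with eval s f (k ∷ v) in eq₁
  ... | nothing = cong pred (searchState-stable (suc k) step refl b)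
    where
    step : searchState (suc k) ≡ 0
    step rewrite eq | eq₁ = refl
  ... | just zero = cong pred (searchState-stable (suc k) step refl b)
    where
    step : searchState (suc k) ≡ 2 + k
    step rewrite eq | eq₁ = refl
  ... | just (suc x) = search-searchState b (suc k) step
    where
    step : searchState (suc k) ≡ 1
    step rewrite eq | eq₁ = refl

mutual
  -- The recursion on the code `e` takes place at the meta level, with the fuel as an ordinary
  -- argument, so each code gets its own computable clock.
  clock : ∀ {n} (e : PR n) → Clocked (λ s → eval s e)
  clock e = clock-suc (λ s → eval s e) (λ v → refl) (clock⁺ e)

  clock⁺ : ∀ {n} (e : PR n) → Clocked (λ s → eval (suc s) e)
  clock⁺ zer = constᶜ 1
  clock⁺ succ = ext (sucᶜ (sucᶜ x₁)) λ { (s ∷ x ∷ []) → refl }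
  clock⁺ (proj i) = ext (sucᶜ (var (suc i))) λ { (s ∷ v) → refl }
  clock⁺ (comp f gs) =
    ext (ifᶜ (clockDefined gs) (clock f ∘ᶜ (x₀ ∷ᶜ clockValues gs)) (constᶜ 0)) lem
    where
    lem : ∀ w → (if defined gs (lookup w zero) (tail w)
        then encode (eval (lookup w zero) f (values gs (lookup w zero) (tail w))) else 0)
      ≡ encode (eval (suc (lookup w zero)) (comp f gs) (tail w))
    lem (s ∷ v) rewrite evalVec-defined gs s v with defined gs s v
    ... | false = refl
    ... | true  = refl
  clock⁺ {suc n} (prec f g) = ext
    (primrec₀ᶜ {f = λ w → encode (eval (lookup w zero) f (tail w))}
      (clock f)
      (ifᶜ (constᶜ 0 <ᶜ x₁) (clock g ∘ᶜ (x₂ ∷ᶜ x₀ ∷ᶜ predᶜ x₁ ∷ᶜ tail³ᶜ)) (constᶜ 0))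
      -- The recursion argument moves to the front and the fuel becomes a parameter.
      ∘ᶜ (x₁ ∷ᶜ x₀ ∷ᶜ tail²ᶜ))
    λ { (s ∷ x ∷ v) → lem s x v }
    where
    tail³ᶜ : CompVec {3 + n} (λ v → tail (tail (tail v)))
    tail³ᶜ = extVec (renaming′ (λ i → suc (suc (suc i)))) λ { (x ∷ y ∷ z ∷ v) → tabulate∘lookup v }
    lem : ∀ s x v →
      primrec {suc n} (λ w → encode (eval (lookup w zero) f (tail w)))
        (λ w → if 0 <ᵇ lookup w (suc zero)
          then encode (eval (lookup w (suc (suc zero))) g
            (lookup w zero ∷ pred (lookup w (suc zero)) ∷ tail (tail (tail w))))
          else 0)
        x (s ∷ v)
      ≡ encode (evalRec s f g x v)
    lem s zero v = refl
    lem s (suc x) v rewrite lem s x v with evalRec s f g x v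
    ... | nothing = refl
    ... | just r  = refl
  clock⁺ {n} (mu f) = ext
    (predᶜ (primrec₀ᶜ {f = λ _ → 1}
      (constᶜ 1)
      (ifᶜ (x₁ ≡ᶜ constᶜ 1)
        (ifᶜ (constᶜ 0 <ᶜ c) (ifᶜ (c ≡ᶜ constᶜ 1) (constᶜ 2 +ᶜ x₀) (constᶜ 1)) (constᶜ 0))
        x₁)
      ∘ᶜ (x₀ ∷ᶜ idᶜ)))
    λ { (s ∷ v) → trans (cong pred (lem s v s)) (search-searchState f s v s 0 refl) }
    where
    c : Comp {3 + n} (λ w →
      encode (eval (lookup w (suc (suc zero))) f (lookup w zero ∷ tail (tail (tail w)))))
    c = clock f ∘ᶜ (x₂ ∷ᶜ x₀ ∷ᶜ
      extVec (renaming′ (λ i → suc (suc (suc i)))) λ { (x ∷ y ∷ z ∷ v) → tabulate∘lookup v })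
    lem : ∀ s v k → primrec {suc n} (λ _ → 1)
      (λ w → if lookup w (suc zero) ≡ᵇ 1
        then probe f (lookup w (suc (suc zero))) (tail (tail (tail w))) (lookup w zero)
          (encode (eval (lookup w (suc (suc zero))) f (lookup w zero ∷ tail (tail (tail w)))))
        else lookup w (suc zero))
      k (s ∷ v) ≡ searchState f s v k
    lem s v zero = refl
    lem s v (suc k) rewrite lem s v k = refl

  clockValues : ∀ {n m} (gs : Vec (PR n) m) → CompVec (λ w → values gs (lookup w zero) (tail w))
  clockValues []       = []ᶜ
  clockValues (g ∷ gs) = predᶜ (clock g) ∷ᶜ clockValues gs

  clockDefined : ∀ {n m} (gs : Vec (PR n) m) → CompB (λ w → defined gs (lookup w zero) (tail w))
  clockDefined []       = trueᶜ
  clockDefined (g ∷ gs) = (constᶜ 0 <ᶜ clock g) ∧ᶜ clockDefined gs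

-- Boolean predicates and counting

<ᵇ-true : ∀ {m n} → m < n → (m <ᵇ n) ≡ true
<ᵇ-true m<n = Equivalence.to T-≡ (<⇒<ᵇ m<n)

<ᵇ-true⁻¹ : ∀ {m n} → (m <ᵇ n) ≡ true → m < n
<ᵇ-true⁻¹ {m} {n} eq = <ᵇ⇒< m n (Equivalence.from T-≡ eq)

<ᵇ-false : ∀ {m n} → n ≤ m → (m <ᵇ n) ≡ false
<ᵇ-false {m} {n} n≤m with m <ᵇ n in eq
... | false = refl
... | true  = contradiction (<ᵇ-true⁻¹ eq) (≤⇒≯ n≤m)

<ᵇ-false⁻¹ : ∀ {m n} → (m <ᵇ n) ≡ false → n ≤ m
<ᵇ-false⁻¹ {m} {n} eq with n ≤? m
... | yes n≤m = n≤m
... | no  n≰m with () ← trans (sym eq) (<ᵇ-true (≰⇒> n≰m))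

≡ᵇ-true : ∀ m → (m ≡ᵇ m) ≡ true
≡ᵇ-true m = Equivalence.to T-≡ (≡⇒≡ᵇ m m refl)

≡ᵇ-true⁻¹ : ∀ {m n} → (m ≡ᵇ n) ≡ true → m ≡ n
≡ᵇ-true⁻¹ {m} {n} eq = ≡ᵇ⇒≡ m n (Equivalence.from T-≡ eq)

∧-true⁻¹ : ∀ {a b} → (a ∧ b) ≡ true → a ≡ true × b ≡ true
∧-true⁻¹ {true} eq = refl , eq

∧-true : ∀ {a b} → a ≡ true → b ≡ true → (a ∧ b) ≡ true
∧-true refl eq = eq

#<-≤ : ∀ n p → #< n p ≤ n
#<-≤ zero p = z≤n
#<-≤ (suc n) p with p n
... | false = ≤-trans (+-monoˡ-≤ 0 (#<-≤ n p)) (≤-trans (≤-reflexive (+-identityʳ n)) (n≤1+n n))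
... | true  = ≤-trans (+-monoˡ-≤ 1 (#<-≤ n p)) (≤-reflexive (+-comm n 1))

#<-all : ∀ n p → (∀ j → j < n → p j ≡ true) → #< n p ≡ n
#<-all zero p all = refl
#<-all (suc n) p all rewrite all n ≤-refl | #<-all n p (λ j j<n → all j (m<n⇒m<1+n j<n)) = +-comm n 1

#<-cong : ∀ n {p q : ℕ → Bool} → (∀ j → j < n → p j ≡ q j) → #< n p ≡ #< n q
#<-cong zero eq = refl
#<-cong (suc n) eq = cong₂ _+_ (#<-cong n (λ j j<n → eq j (m<n⇒m<1+n j<n))) (cong boolToℕ (eq n ≤-refl))

#<-extend : ∀ {m n} p → m ≤ n → (∀ j → m ≤ j → j < n → p j ≡ false) → #< n p ≡ #< m p
#<-extend {m} {n} p m≤n none = go (≤⇒≤′ m≤n) none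
  where
  go : ∀ {n} → m ≤′ n → (∀ j → m ≤ j → j < n → p j ≡ false) → #< n p ≡ #< m p
  go ≤′-refl none = refl
  go (≤′-step {n} m≤n) none rewrite none n (≤′⇒≤ m≤n) ≤-refl | +-identityʳ (#< n p) =
    go m≤n (λ j m≤j j<n → none j m≤j (m<n⇒m<1+n j<n))

boolToℕ-mono : ∀ {a b} → (a ≡ true → b ≡ true) → boolToℕ a ≤ boolToℕ b
boolToℕ-mono {false} imp = z≤n
boolToℕ-mono {true} imp rewrite imp refl = ≤-refl

#<-mono : ∀ n {p q : ℕ → Bool} → (∀ j → j < n → p j ≡ true → q j ≡ true) → #< n p ≤ #< n q
#<-mono zero imp = z≤n
#<-mono (suc n) imp = +-mono-≤ (#<-mono n (λ j j<n → imp j (m<n⇒m<1+n j<n))) (boolToℕ-mono (imp n ≤-refl))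

#<-monoˡ : ∀ {m n} p → m ≤ n → #< m p ≤ #< n p
#<-monoˡ {m} p m≤n = go (≤⇒≤′ m≤n)
  where
  go : ∀ {n} → m ≤′ n → #< m p ≤ #< n p
  go ≤′-refl = ≤-refl
  go (≤′-step m≤n) = ≤-trans (go m≤n) (m≤m+n _ _)

all<-cong : ∀ n {p q : ℕ → Bool} → (∀ j → j < n → p j ≡ q j) → all< n p ≡ all< n q
all<-cong zero eq = refl
all<-cong (suc n) eq = cong₂ _∧_ (all<-cong n (λ j j<n → eq j (m<n⇒m<1+n j<n))) (eq n ≤-refl)

all<-true⁻¹ : ∀ n {p} → all< n p ≡ true → ∀ j → j < n → p j ≡ true
all<-true⁻¹ (suc n) eq j j<1+n with m≤n⇒m<n∨m≡n (s≤s⁻¹ j<1+n)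
... | inj₁ j<n  = all<-true⁻¹ n (proj₁ (∧-true⁻¹ eq)) j j<n
... | inj₂ refl = proj₂ (∧-true⁻¹ {all< n _} eq)

all<-true : ∀ n {p} → (∀ j → j < n → p j ≡ true) → all< n p ≡ true
all<-true zero all = refl
all<-true (suc n) all = ∧-true (all<-true n (λ j j<n → all j (m<n⇒m<1+n j<n))) (all n ≤-refl)

all<-false⁻¹ : ∀ n {p} → all< n p ≡ false → ∃ λ j → j < n × p j ≡ false
all<-false⁻¹ (suc n) {p} eq with all< n p in eq₁
... | false = let j , j<n , pj = all<-false⁻¹ n eq₁ in j , m<n⇒m<1+n j<n , pj
... | true  = n , ≤-refl , eq

-- Course-of-values recursion

opaque

  -- Since `a ≤ a + b`, the code is at least the square of `a + b` and below the next square, so its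
  -- integer square root recovers `a + b`.
  pair : ℕ → ℕ → ℕ
  pair a b = (a + b) * (a + b) + a

  sqrt : ℕ → ℕ
  sqrt p = #< p (λ j → suc j * suc j <ᵇ suc p)

  fst : ℕ → ℕ
  fst p = p ∸ sqrt p * sqrt p

  snd : ℕ → ℕ
  snd p = sqrt p ∸ fst p

  n≤n*n : ∀ n → n ≤ n * n
  n≤n*n zero    = z≤n
  n≤n*n (suc n) = m≤m+n (suc n) (n * suc n)

  sqrt-pair : ∀ a b → sqrt (pair a b) ≡ a + b
  sqrt-pair a b = trans (#<-extend _ q≤p none) (#<-all q _ all)
    where
    q p : ℕ
    q = a + b
    p = pair a b
    q≤p : q ≤ p
    q≤p = ≤-trans (n≤n*n q) (m≤m+n (q * q) a)
    p<[1+q]² : p < suc q * suc q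
    p<[1+q]² = s≤s (begin
      q * q + a           ≤⟨ +-monoʳ-≤ (q * q) (m≤m+n a b) ⟩
      q * q + q           ≤⟨ m≤m+n _ q ⟩
      q * q + q + q       ≡⟨ lem q ⟩
      q + q * suc q       ∎)
      where
      open ≤-Reasoning
      lem : ∀ q → q * q + q + q ≡ q + q * suc q
      lem = solve-∀
    none : ∀ j → q ≤ j → j < p → (suc j * suc j <ᵇ suc p) ≡ false
    none j q≤j _ = <ᵇ-false (≤-trans p<[1+q]² (*-mono-≤ (s≤s q≤j) (s≤s q≤j)))
    all : ∀ j → j < q → (suc j * suc j <ᵇ suc p) ≡ true
    all j j<q = <ᵇ-true (s≤s (≤-trans (*-mono-≤ j<q j<q) (m≤m+n (q * q) a)))

  fst-pair : ∀ a b → fst (pair a b) ≡ a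
  fst-pair a b rewrite sqrt-pair a b = m+n∸m≡n ((a + b) * (a + b)) a

  snd-pair : ∀ a b → snd (pair a b) ≡ b
  snd-pair a b rewrite fst-pair a b | sqrt-pair a b = m+n∸m≡n a b

  ≤-pairʳ : ∀ a b → b ≤ pair a b
  ≤-pairʳ a b = ≤-trans (m≤n+m b a) (≤-trans (n≤n*n (a + b)) (m≤m+n _ a))

  pairᶜ : ∀ {n} {f g : Vec ℕ n → ℕ} → Comp f → Comp g → Comp (λ v → pair (f v) (g v))
  pairᶜ cf cg = (cf +ᶜ cg) *ᶜ (cf +ᶜ cg) +ᶜ cf

  sqrtᶜ : ∀ {n} {f : Vec ℕ n → ℕ} → Comp f → Comp (λ v → sqrt (f v))
  sqrtᶜ cf = #<ᶜ x₀ (sucᶜ x₀ *ᶜ sucᶜ x₀ <ᶜ sucᶜ x₁) ∘ᶜ (cf ∷ᶜ []ᶜ)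

  fstᶜ : ∀ {n} {f : Vec ℕ n → ℕ} → Comp f → Comp (λ v → fst (f v))
  fstᶜ cf = cf ∸ᶜ sqrtᶜ cf *ᶜ sqrtᶜ cf

  sndᶜ : ∀ {n} {f : Vec ℕ n → ℕ} → Comp f → Comp (λ v → snd (f v))
  sndᶜ cf = sqrtᶜ cf ∸ᶜ fstᶜ cf

drop : ℕ → ℕ → ℕ
drop zero    h = h
drop (suc i) h = snd (drop i h)

dropᶜ : ∀ {n} {f g : Vec ℕ n → ℕ} → Comp f → Comp g → Comp (λ v → drop (f v) (g v))
dropᶜ {n} {f} {g} cf cg = ext (primrecᶜ cg (sndᶜ x₁) cf) λ v → lem v (f v)
  where
  lem : ∀ v k → primrec g (λ w → snd (lookup w (suc zero))) k v ≡ drop k (g v)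
  lem v zero    = refl
  lem v (suc k) = cong snd (lem v k)

-- [at x h y] is the value at y < x recorded in the history h of the values below x.
at : ℕ → ℕ → ℕ → ℕ
at x h y = fst (drop (x ∸ suc y) h)

atᶜ : ∀ {n} {a b c : Vec ℕ n → ℕ} → Comp a → Comp b → Comp c → Comp (λ v → at (a v) (b v) (c v))
atᶜ ca cb cc = fstᶜ (dropᶜ (ca ∸ᶜ sucᶜ cc) cb)

module CourseOfValues (step : ℕ → (ℕ → ℕ) → ℕ)
  (step-cong : ∀ x {r r′ : ℕ → ℕ} → (∀ y → y < x → r y ≡ r′ y) → step x r ≡ step x r′) where

  opaque

    -- The most recent value comes first, so the value at `y` sits `x ∸ suc y` entries deep.
    history : ℕ → ℕ
    history zero    = 0
    history (suc x) = pair (step x (at x (history x))) (history x)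

    value : ℕ → ℕ
    value x = fst (history (suc x))

    drop-history : ∀ i x → drop i (history (i + x)) ≡ history x
    drop-history zero    x = refl
    drop-history (suc i) x = begin
      snd (drop i (history (suc i + x))) ≡⟨ cong (λ z → snd (drop i (history z))) (+-suc i x) ⟨
      snd (drop i (history (i + suc x))) ≡⟨ cong snd (drop-history i (suc x)) ⟩
      snd (history (suc x))              ≡⟨ snd-pair (step x (at x (history x))) (history x) ⟩
      history x                          ∎
      where open ≡-Reasoning

    at-history : ∀ x y → y < x → at x (history x) y ≡ value y
    at-history x y y<x = cong fst (begin
      drop (x ∸ suc y) (history x)                   ≡⟨ cong (λ z → drop (x ∸ suc y) (history z)) (m∸n+n≡m y<x) ⟨
      drop (x ∸ suc y) (history (x ∸ suc y + suc y)) ≡⟨ drop-history (x ∸ suc y) (suc y) ⟩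
      history (suc y)                                ∎)
      where open ≡-Reasoning

    value-step : ∀ x → value x ≡ step x value
    value-step x = trans (fst-pair (step x (at x (history x))) (history x)) (step-cong x (at-history x))

    -- `step` takes a function as argument; its computability is asked for arguments of the form
    -- `at x h`, where the history `h` is passed as a number.
    valueᶜ : Comp {2} (λ v → step (lookup v zero) (at (lookup v zero) (lookup v (suc zero)))) →
      ∀ {n} {f : Vec ℕ n → ℕ} → Comp f → Comp (λ v → value (f v))
    valueᶜ cs {f = f} cf = fstᶜ (historyᶜ ∘ᶜ (sucᶜ cf ∷ᶜ []ᶜ))
      where
      historyᶜ : Comp {1} (λ v → history (lookup v zero))
      historyᶜ = ext (primrec₀ᶜ {f = λ _ → 0} (constᶜ 0) (pairᶜ (cs ∘ᶜ (x₀ ∷ᶜ x₁ ∷ᶜ []ᶜ)) x₁))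
        λ { (x ∷ []) → lem x }
        where
        lem : ∀ x → primrec {0} (λ _ → 0) (λ w → pair (step (lookup w zero)
            (at (lookup w zero) (lookup w (suc zero)))) (lookup w (suc zero))) x []
          ≡ history x
        lem zero    = refl
        lem (suc x) rewrite lem x = refl

-- The colored order

-- A label is pair (host , pair (color , serial number)), so that every combination of host and color
-- occurs infinitely often.
host color : ℕ → ℕ
host x  = fst x
color x = fst (snd x)

hostᶜ : ∀ {n} {f : Vec ℕ n → ℕ} → Comp f → Comp (λ v → host (f v))
hostᶜ = fstᶜ

colorᶜ : ∀ {n} {f : Vec ℕ n → ℕ} → Comp f → Comp (λ v → color (f v))
colorᶜ c = fstᶜ (sndᶜ c)

module Order (out : ℕ → ℕ → Bool) (outᶜ : CompRel out) where

  -- [out x j]: the number j has been seen to be outside C by stage x.  A label b is low at stage x for k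
  -- if it is at most the k-th (counting from 0) remaining number.
  remaining : ℕ → ℕ → ℕ
  remaining x b = #< b (λ j → not (out x j))

  low : ℕ → ℕ → ℕ → Bool
  low x k b = remaining x b <ᵇ suc k

  -- The bound k of block `t` as known at stage `x`; it grows with `x` until the earlier blocks are
  -- complete.
  budget : (ℕ → ℕ) → ℕ → ℕ → ℕ
  budget r x t = t + #< x (λ y → r y <ᵇ t)

  -- [r z <ᵇ z] says that z has been inserted, [r] being the function root defined below.
  separates : (ℕ → ℕ) → ℕ → ℕ → Bool
  separates r x z = (host z ≡ᵇ host x) ∧ (color z ≡ᵇ color x) ∧ (r z <ᵇ z)

  -- A rival `z` (inserted earlier with the same host and color) that is not low is younger than
  -- every low label, so it already separates the host from all low labels below it. A new insertion
  -- is called for only while every rival is itself low.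
  admissible : ℕ → (ℕ → ℕ) → Bool
  admissible x r =
    (color x <ᵇ suc (r (host x))) ∧
    low x (budget r x (r (host x))) (host x) ∧
    all< x (λ z → not (separates r x z) ∨ low x (budget r x (r (host x))) z)

  rootStep : ℕ → (ℕ → ℕ) → ℕ
  rootStep x r = if (host x <ᵇ x) ∧ admissible x r then r (host x) else x

  module _ (x : ℕ) {r r′ : ℕ → ℕ} (r≈r′ : ∀ y → y < x → r y ≡ r′ y) where

    budget-cong : ∀ t → budget r x t ≡ budget r′ x t
    budget-cong t = cong (t +_) (#<-cong x λ y y<x → cong (_<ᵇ t) (r≈r′ y y<x))

    admissible-cong : host x < x → admissible x r ≡ admissible x r′
    admissible-cong b<x rewrite r≈r′ (host x) b<x | budget-cong (r′ (host x)) =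
      cong (λ c → (color x <ᵇ suc (r′ (host x))) ∧ low x (budget r′ x (r′ (host x))) (host x) ∧ c)
        (all<-cong x λ z z<x →
          cong (λ y → not ((host z ≡ᵇ host x) ∧ (color z ≡ᵇ color x) ∧ (y <ᵇ z)) ∨
            low x (budget r′ x (r′ (host x))) z) (r≈r′ z z<x))

    rootStep-cong : rootStep x r ≡ rootStep x r′
    rootStep-cong with host x <ᵇ x in eq
    ... | false = refl
    ... | true rewrite admissible-cong (<ᵇ-true⁻¹ eq) | r≈r′ (host x) (<ᵇ-true⁻¹ eq) = refl

  module Root = CourseOfValues rootStep rootStep-cong

  opaque

    root : ℕ → ℕ
    root = Root.value

    inserted : ℕ → Bool
    inserted x = (host x <ᵇ x) ∧ admissible x root

    inserted≡ : ∀ x → inserted x ≡ (host x <ᵇ x) ∧ admissible x root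
    inserted≡ x = refl

    root-step : ∀ x → root x ≡ (if inserted x then root (host x) else x)
    root-step = Root.value-step

    rootᶜ : ∀ {n} {f : Vec ℕ n → ℕ} → Comp f → Comp (λ v → root (f v))
    rootᶜ = Root.valueᶜ (ifᶜ
      (hostᶜ x₀ <ᶜ x₀ ∧ᶜ (colorᶜ x₀ <ᶜ sucᶜ tᶜ) ∧ᶜ (remainingᶜ x₀ (hostᶜ x₀) <ᶜ sucᶜ kᶜ) ∧ᶜ
        all<ᶜ x₀ (notᶜ (hostᶜ x₀ ≡ᶜ hostᶜ x₁ ∧ᶜ colorᶜ x₀ ≡ᶜ colorᶜ x₁ ∧ᶜ (atᶜ x₁ x₂ x₀ <ᶜ x₀)) ∨ᶜ
          remainingᶜ x₁ x₀ <ᶜ sucᶜ (kᶜ ∘ᶜ (x₁ ∷ᶜ x₂ ∷ᶜ []ᶜ))))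
      tᶜ x₀)
      where
      remainingᶜ : ∀ {n} {f g : Vec ℕ n → ℕ} → Comp f → Comp g → Comp (λ v → remaining (f v) (g v))
      remainingᶜ cf cg = #<ᶜ x₁ (notᶜ (on₂ outᶜ x₁ x₀)) ∘ᶜ (cf ∷ᶜ cg ∷ᶜ []ᶜ)
      tᶜ : Comp {2} (λ v → at (lookup v zero) (lookup v (suc zero)) (host (lookup v zero)))
      tᶜ = atᶜ x₀ x₁ (hostᶜ x₀)
      kᶜ : Comp {2} (λ v → budget (at (lookup v zero) (lookup v (suc zero))) (lookup v zero)
        (at (lookup v zero) (lookup v (suc zero)) (host (lookup v zero))))
      kᶜ = tᶜ +ᶜ #<ᶜ x₀ (atᶜ x₁ x₂ x₀ <ᶜ (tᶜ ∘ᶜ (x₁ ∷ᶜ x₂ ∷ᶜ []ᶜ)))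

  inserted⇒host< : ∀ {x} → inserted x ≡ true → host x < x
  inserted⇒host< {x} eq = <ᵇ-true⁻¹ (proj₁ (∧-true⁻¹ (trans (sym (inserted≡ x)) eq)))

  root-inserted : ∀ {x} → inserted x ≡ true → root x ≡ root (host x)
  root-inserted {x} eq = trans (root-step x) (cong (if_then root (host x) else x) eq)

  root-top : ∀ {x} → inserted x ≡ false → root x ≡ x
  root-top {x} eq = trans (root-step x) (cong (if_then root (host x) else x) eq)

  root≤ : ∀ x → root x ≤ x
  root≤ = <-rec _ go
    where
    go : ∀ x → (∀ {y} → y < x → root y ≤ y) → root x ≤ x
    go x rec with inserted x in eq
    ... | false = ≤-reflexive (root-top eq)
    ... | true  = ≤-trans (≤-reflexive (root-inserted eq))
                    (≤-trans (rec (inserted⇒host< eq)) (<⇒≤ (inserted⇒host< eq)))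

  -- Insertion can be read off the root alone. This makes `inserted` computable from `rootᶜ`, and it
  -- is why `separates` can refer to earlier insertions through `r`.
  root<ᵇ : ∀ x → (root x <ᵇ x) ≡ inserted x
  root<ᵇ x with inserted x in eq
  ... | false = <ᵇ-false (≤-reflexive (sym (root-top eq)))
  ... | true  = <ᵇ-true (≤-<-trans (≤-reflexive (root-inserted eq))
                  (≤-<-trans (root≤ (host x)) (inserted⇒host< eq)))

  -- [key x / 2 ^ (1 + x)] is the position of x on the rational line: x + 1 for a new maximum,
  -- and the position of the host minus [1 / 2 ^ (1 + x)] for an inserted x.
  keyStep : ℕ → (ℕ → ℕ) → ℕ
  keyStep x r = if root x <ᵇ x then r (host x) * 2 ^ (x ∸ host x) ∸ 1 else suc x * 2 ^ suc x

  keyStep-cong : ∀ x {r r′ : ℕ → ℕ} → (∀ y → y < x → r y ≡ r′ y) → keyStep x r ≡ keyStep x r′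
  keyStep-cong x r≈r′ rewrite root<ᵇ x with inserted x in eq
  ... | false = refl
  ... | true  = cong (λ k → k * 2 ^ (x ∸ host x) ∸ 1) (r≈r′ (host x) (inserted⇒host< eq))

  module Key = CourseOfValues keyStep keyStep-cong

  opaque

    key : ℕ → ℕ
    key = Key.value

    key-step : ∀ x → key x ≡ (if inserted x then key (host x) * 2 ^ (x ∸ host x) ∸ 1 else suc x * 2 ^ suc x)
    key-step x = trans (Key.value-step x)
      (cong (if_then key (host x) * 2 ^ (x ∸ host x) ∸ 1 else suc x * 2 ^ suc x) (root<ᵇ x))

    keyᶜ : ∀ {n} {f : Vec ℕ n → ℕ} → Comp f → Comp (λ v → key (f v))
    keyᶜ = Key.valueᶜ (ifᶜ (rootᶜ x₀ <ᶜ x₀)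
      (atᶜ x₀ x₁ (hostᶜ x₀) *ᶜ 2^ᶜ (x₀ ∸ᶜ hostᶜ x₀) ∸ᶜ constᶜ 1)
      (sucᶜ x₀ *ᶜ 2^ᶜ (sucᶜ x₀)))

  key-inserted : ∀ {x} → inserted x ≡ true → key x ≡ key (host x) * 2 ^ (x ∸ host x) ∸ 1
  key-inserted {x} eq = trans (key-step x)
    (cong (if_then key (host x) * 2 ^ (x ∸ host x) ∸ 1 else suc x * 2 ^ suc x) eq)

  key-top : ∀ {x} → inserted x ≡ false → key x ≡ suc x * 2 ^ suc x
  key-top {x} eq = trans (key-step x)
    (cong (if_then key (host x) * 2 ^ (x ∸ host x) ∸ 1 else suc x * 2 ^ suc x) eq)

  -- Compares the positions `key x / 2 ^ (1 + x)` and `key y / 2 ^ (1 + y)` by cross multiplication,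
  -- with the common factor 2 cancelled.
  lt : ℕ → ℕ → Bool
  lt x y = key x * 2 ^ y <ᵇ key y * 2 ^ x

  infix 4 _≺_
  _≺_ : ℕ → ℕ → Set
  x ≺ y = key x * 2 ^ y < key y * 2 ^ x

  insertedᶜ : ∀ {n} {f : Vec ℕ n → ℕ} → Comp f → CompB (λ v → inserted (f v))
  insertedᶜ {f = f} c = extB (rootᶜ c <ᶜ c) λ v → root<ᵇ (f v)

  ltᶜ : ∀ {n} {f g : Vec ℕ n → ℕ} → Comp f → Comp g → CompB (λ v → lt (f v) (g v))
  ltᶜ cf cg = keyᶜ cf *ᶜ 2^ᶜ cg <ᶜ keyᶜ cg *ᶜ 2^ᶜ cf

  2^-split : ∀ {b x} → b ≤ x → 2 ^ (x ∸ b) * 2 ^ b ≡ 2 ^ x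
  2^-split {b} {x} b≤x = trans (sym (^-distribˡ-+-* 2 (x ∸ b) b)) (cong (2 ^_) (m∸n+n≡m b≤x))

  2^-even : ∀ {b x} → b < x → 2 ^ (x ∸ b) ≡ 2 * 2 ^ (x ∸ suc b)
  2^-even {b} {x} b<x = cong (2 ^_) (trans (sym (m+[n∸m]≡n {1} (m<n⇒0<n∸m b<x))) (cong suc
    (trans (∸-+-assoc x b 1) (cong (x ∸_) (+-comm b 1)))))

  -- Block `t` occupies the interval from `t`, excluded, to `t + 1`, included. The lower bound
  -- survives an insertion: the host's numerator exceeds that of `t` by at least 1, passing to the
  -- denominator of `x` multiplies this excess by at least 2, and only 1 is subtracted.
  key-bounds : ∀ x → root x * 2 ^ suc x < key x × key x ≤ suc (root x) * 2 ^ suc x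
  key-bounds = <-rec _ go
    where
    open ≤-Reasoning
    go : ∀ x → (∀ {y} → y < x → root y * 2 ^ suc y < key y × key y ≤ suc (root y) * 2 ^ suc y) →
      root x * 2 ^ suc x < key x × key x ≤ suc (root x) * 2 ^ suc x
    go x rec with inserted x in eq
    ... | false rewrite root-top eq | key-top eq =
      *-monoˡ-< (2 ^ suc x) {{m^n≢0 2 (suc x)}} (n<1+n x) , ≤-refl
    ... | true  rewrite root-inserted eq | key-inserted eq = lower , upper
      where
      b = host x
      b<x = inserted⇒host< eq
      t = root b
      e = 2 ^ (x ∸ b)
      e≥2 : 2 ≤ e
      e≥2 = ≤-trans (*-monoʳ-≤ 2 (>-nonZero⁻¹ _ {{m^n≢0 2 (x ∸ suc b)}})) (≤-reflexive (sym (2^-even b<x)))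
      scale : ∀ m → m * 2 ^ suc x ≡ m * 2 ^ suc b * e
      scale m = begin-equality
        m * (2 * 2 ^ x)         ≡⟨ cong (λ z → m * (2 * z)) (2^-split (<⇒≤ b<x)) ⟨
        m * (2 * (e * 2 ^ b))   ≡⟨ lem m e (2 ^ b) ⟩
        m * (2 * 2 ^ b) * e     ∎
        where
        lem : ∀ m e c → m * (2 * (e * c)) ≡ m * (2 * c) * e
        lem = solve-∀
      upper : key b * e ∸ 1 ≤ suc t * 2 ^ suc x
      upper = begin
        key b * e ∸ 1           ≤⟨ m∸n≤m _ 1 ⟩
        key b * e               ≤⟨ *-monoˡ-≤ e (proj₂ (rec b<x)) ⟩
        suc t * 2 ^ suc b * e   ≡⟨ scale (suc t) ⟨
        suc t * 2 ^ suc x       ∎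
      lower : t * 2 ^ suc x < key b * e ∸ 1
      lower = ∸-monoˡ-≤ 1 (begin
        2 + t * 2 ^ suc x        ≤⟨ +-monoˡ-≤ _ e≥2 ⟩
        e + t * 2 ^ suc x        ≡⟨ cong (e +_) (scale t) ⟩
        suc (t * 2 ^ suc b) * e  ≤⟨ *-monoˡ-≤ e (proj₁ (rec b<x)) ⟩
        key b * e                ∎)

  ≺⇒lt : ∀ {x y} → x ≺ y → lt x y ≡ true
  ≺⇒lt = <ᵇ-true

  lt⇒≺ : ∀ {x y} → lt x y ≡ true → x ≺ y
  lt⇒≺ = <ᵇ-true⁻¹

  ≺-irrefl : ∀ {x} → ¬ x ≺ x
  ≺-irrefl = <-irrefl refl

  ≺-trans : ∀ {x y z} → x ≺ y → y ≺ z → x ≺ z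
  ≺-trans {x} {y} {z} x≺y y≺z = *-cancelʳ-< (2 ^ y) (key x * 2 ^ z) (key z * 2 ^ x) (begin-strict
    key x * 2 ^ z * 2 ^ y  ≡⟨ lem (key x) (2 ^ z) (2 ^ y) ⟩
    key x * 2 ^ y * 2 ^ z  <⟨ *-monoˡ-< (2 ^ z) {{m^n≢0 2 z}} x≺y ⟩
    key y * 2 ^ x * 2 ^ z  ≡⟨ lem (key y) (2 ^ x) (2 ^ z) ⟩
    key y * 2 ^ z * 2 ^ x  <⟨ *-monoˡ-< (2 ^ x) {{m^n≢0 2 x}} y≺z ⟩
    key z * 2 ^ y * 2 ^ x  ≡⟨ lem (key z) (2 ^ y) (2 ^ x) ⟩
    key z * 2 ^ x * 2 ^ y  ∎)
    where
    open ≤-Reasoning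
    lem : ∀ a b c → a * b * c ≡ a * c * b
    lem = solve-∀

  root<⇒≺ : ∀ {x y} → root x < root y → x ≺ y
  root<⇒≺ {x} {y} rx<ry = begin-strict
    key x * 2 ^ y                     ≤⟨ *-monoˡ-≤ (2 ^ y) (proj₂ (key-bounds x)) ⟩
    suc (root x) * 2 ^ suc x * 2 ^ y  ≤⟨ *-monoˡ-≤ (2 ^ y) (*-monoˡ-≤ (2 ^ suc x) rx<ry) ⟩
    root y * 2 ^ suc x * 2 ^ y        ≡⟨ lem (root y) (2 ^ x) (2 ^ y) ⟩
    root y * 2 ^ suc y * 2 ^ x        <⟨ *-monoˡ-< (2 ^ x) {{m^n≢0 2 x}} (proj₁ (key-bounds y)) ⟩
    key y * 2 ^ x                     ∎
    where
    open ≤-Reasoning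
    lem : ∀ a b c → a * (2 * b) * c ≡ a * (2 * c) * b
    lem = solve-∀

  module _ {x} (ins : inserted x ≡ true) where

    private
      b = host x
      b<x = inserted⇒host< ins
      e = 2 ^ (x ∸ b)
      e′ = 2 ^ (x ∸ suc b)

      -- The subtraction of 1 does not truncate, as the host has a positive key.
      key⁺ : suc (key x) ≡ key b * e
      key⁺ = trans (cong suc (key-inserted ins)) (m+[n∸m]≡n (*-mono-≤
        (≤-trans (s≤s z≤n) (proj₁ (key-bounds b))) (>-nonZero⁻¹ e {{m^n≢0 2 (x ∸ b)}})))

    ≺-host : x ≺ host x
    ≺-host = begin-strict
      key x * 2 ^ b        <⟨ *-monoˡ-< (2 ^ b) {{m^n≢0 2 b}} (n<1+n (key x)) ⟩
      suc (key x) * 2 ^ b  ≡⟨ cong (_* 2 ^ b) key⁺ ⟩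
      key b * e * 2 ^ b    ≡⟨ *-assoc (key b) e (2 ^ b) ⟩
      key b * (e * 2 ^ b)  ≡⟨ cong (key b *_) (2^-split (<⇒≤ b<x)) ⟩
      key b * 2 ^ x        ∎
      where open ≤-Reasoning

    module _ {y} (y<x : y < x) where

      private
        u′ = 2 ^ (x ∸ suc y)

        2^x≡ : 2 ^ x ≡ 2 * u′ * 2 ^ y
        2^x≡ = trans (sym (2^-split (<⇒≤ y<x))) (cong (_* 2 ^ y) (2^-even y<x))

        key⁺-even : suc (key x) ≡ 2 * (key b * e′)
        key⁺-even = trans key⁺ (trans (cong (key b *_) (2^-even b<x)) (lem (key b) e′))
          where
          lem : ∀ a c → a * (2 * c) ≡ 2 * (a * c)
          lem = solve-∀

      -- Over the denominator of `x`, the numerators of the older labels `y` and `host x` are both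
      -- even. They differ by at least 2, so subtracting 1 from that of the host stays above `y`.
      ≺-before-host : y ≺ host x → y ≺ x
      ≺-before-host y≺b = begin-strict
        key y * 2 ^ x             ≡⟨ cong (key y *_) 2^x≡ ⟩
        key y * (2 * u′ * 2 ^ y)  ≡⟨ lem (key y) u′ (2 ^ y) ⟩
        2 * (key y * u′) * 2 ^ y  <⟨ *-monoˡ-< (2 ^ y) {{m^n≢0 2 y}} doubled ⟩
        key x * 2 ^ y             ∎
        where
        open ≤-Reasoning
        lem : ∀ a c d → a * (2 * c * d) ≡ 2 * (a * c) * d
        lem = solve-∀
        lem₁ : ∀ a c d → a * c * (2 * d) ≡ a * (2 * d * c)
        lem₁ = solve-∀
        lem₂ : ∀ a c d → a * c * (2 * d) ≡ a * d * (2 * c)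
        lem₂ = solve-∀
        half : key y * u′ < key b * e′
        half = *-cancelʳ-< (2 * 2 ^ y) _ _ (begin-strict
          key y * u′ * (2 * 2 ^ y)      ≡⟨ lem₂ (key y) u′ (2 ^ y) ⟩
          key y * 2 ^ y * (2 * u′)      ≡⟨ lem₁ (key y) (2 ^ y) u′ ⟩
          key y * (2 * u′ * 2 ^ y)      ≡⟨ cong (key y *_) 2^x≡ ⟨
          key y * 2 ^ x                 ≡⟨ cong (key y *_) (2^-split (<⇒≤ b<x)) ⟨
          key y * (e * 2 ^ b)           ≡⟨ cong (λ z → key y * (z * 2 ^ b)) (2^-even b<x) ⟩
          key y * (2 * e′ * 2 ^ b)      ≡⟨ lem₁ (key y) (2 ^ b) e′ ⟨
          key y * 2 ^ b * (2 * e′)      <⟨ *-monoˡ-< (2 * e′) {{m*n≢0 2 e′ {{_}} {{m^n≢0 2 (x ∸ suc b)}}}} y≺b ⟩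
          key b * 2 ^ y * (2 * e′)      ≡⟨ lem₂ (key b) (2 ^ y) e′ ⟩
          key b * e′ * (2 * 2 ^ y)      ∎)
        doubled : 2 * (key y * u′) < key x
        doubled = s≤s⁻¹ (begin
          2 + 2 * (key y * u′)     ≡⟨ *-suc 2 (key y * u′) ⟨
          2 * suc (key y * u′)     ≤⟨ *-monoʳ-≤ 2 half ⟩
          2 * (key b * e′)         ≡⟨ key⁺-even ⟨
          suc (key x)              ∎)

      -- Over the denominator of `x`, the numerator of `x` is odd and that of the older `y` is even.
      key≢ : key x * 2 ^ y ≢ key y * 2 ^ x
      key≢ eq = odd≢even (key b * e′) (key y * u′) (trans (sym key⁺-even) (cong suc
        (*-cancelʳ-≡ _ _ (2 ^ y) {{m^n≢0 2 y}}
        (trans eq (trans (cong (key y *_) 2^x≡) (lem (key y) u′ (2 ^ y)))))))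
        where
        lem : ∀ a c d → a * (2 * c * d) ≡ 2 * (a * c) * d
        lem = solve-∀
        odd≢even : ∀ m n → 2 * m ≢ suc (2 * n)
        odd≢even (suc m) (suc n) eq = odd≢even m n (suc-injective (suc-injective
          (trans (sym (*-suc 2 m)) (trans eq (cong suc (*-suc 2 n))))))
        odd≢even (suc m) zero eq with () ← trans (sym (*-suc 2 m)) eq

  ≺-total-< : ∀ {x y} → y < x → x ≺ y ⊎ y ≺ x
  ≺-total-< {x} {y} y<x with inserted x in ins
  ... | false = inj₂ (root<⇒≺ (≤-<-trans (root≤ y) (<-≤-trans y<x (≤-reflexive (sym (root-top ins))))))
  ... | true with <-cmp (key x * 2 ^ y) (key y * 2 ^ x)
  ...   | tri< x≺y _ _ = inj₁ x≺y
  ...   | tri≈ _ eq _  = contradiction eq (key≢ ins y<x)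
  ...   | tri> _ _ y≺x = inj₂ y≺x

  ≺-total : ∀ x y → x ≡ y ⊎ x ≺ y ⊎ y ≺ x
  ≺-total x y with <-cmp x y
  ... | tri≈ _ eq _ = inj₁ eq
  ... | tri> _ _ y<x = inj₂ (≺-total-< y<x)
  ... | tri< x<y _ _ with ≺-total-< x<y
  ...   | inj₁ y≺x = inj₂ (inj₂ y≺x)
  ...   | inj₂ x≺y = inj₂ (inj₁ x≺y)

-- A criterion for order type ω

<suc-split : ∀ {j n} → j < suc n → j < n ⊎ j ≡ n
<suc-split j<1+n = m≤n⇒m<n∨m≡n (s≤s⁻¹ j<1+n)

<suc-elim : ∀ {n} {P : ℕ → Set} → (∀ j → j < n → P j) → P n → ∀ j → j < suc n → P j
<suc-elim below at-n j j<1+n with <suc-split j<1+n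
... | inj₁ j<n  = below j j<n
... | inj₂ refl = at-n

#<-strict : ∀ n {p q : ℕ → Bool} → (∀ j → j < n → p j ≡ true → q j ≡ true) →
  ∀ a → a < n → p a ≡ false → q a ≡ true → #< n p < #< n q
#<-strict (suc n) {p} {q} imp a a<1+n pa qa with <suc-split a<1+n
... | inj₁ a<n  = +-mono-<-≤ (#<-strict n (λ j j<n → imp j (m<n⇒m<1+n j<n)) a a<n pa qa)
                    (boolToℕ-mono (imp n ≤-refl))
... | inj₂ refl rewrite pa | qa =
  +-mono-≤-< (#<-mono n {p} {q} (λ j j<n → imp j (m<n⇒m<1+n j<n))) (s≤s z≤n)

-- Serves with `a` the immediate predecessor of an element, to show that the rank grows by at most
-- one from `a` to that element.
#<-insert : ∀ n {p q : ℕ → Bool} a → (∀ j → j < n → p j ≡ true → q j ≡ true ⊎ j ≡ a) →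
  #< n p ≤ suc (#< n q)
#<-insert zero a imp = z≤n
#<-insert (suc n) {p} {q} a imp with #<-insert n {p} {q} a (λ j j<n → imp j (m<n⇒m<1+n j<n)) | p n in eq
... | ih | false = +-mono-≤ ih z≤n
... | ih | true with imp n ≤-refl eq
...   | inj₁ qn rewrite qn = +-monoˡ-≤ 1 ih
...   | inj₂ refl = begin
  #< n p + 1                       ≡⟨ +-comm _ 1 ⟩
  suc (#< n p)                     ≤⟨ s≤s (#<-mono n λ j j<n pj → below j j<n (imp j (m<n⇒m<1+n j<n) pj)) ⟩
  suc (#< n q)                     ≤⟨ m≤m+n _ (boolToℕ (q n)) ⟩
  suc (#< n q + boolToℕ (q n))     ∎
  where
  open ≤-Reasoning
  below : ∀ j → j < n → q j ≡ true ⊎ j ≡ n → q j ≡ true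
  below j j<n (inj₁ qj) = qj
  below j j<n (inj₂ refl) = contradiction j<n (<-irrefl refl)

-- Pigeonhole by induction on `N`: when `N` itself is counted, its image is deleted from the target
-- (`q′`) before the induction hypothesis is applied.
#<-injection : ∀ N M {p q : ℕ → Bool} (f : ℕ → ℕ) →
  (∀ j → j < N → p j ≡ true → f j < M × q (f j) ≡ true) →
  (∀ i j → i < j → j < N → p i ≡ true → p j ≡ true → f i ≢ f j) →
  #< N p ≤ #< M q
#<-injection zero M f maps inj = z≤n
#<-injection (suc N) M {p} {q} f maps inj with p N in eq
... | false = ≤-trans (≤-reflexive (+-identityʳ _)) (#<-injection N M f
  (λ j j<N → maps j (m<n⇒m<1+n j<N)) (λ i j i<j j<N → inj i j i<j (m<n⇒m<1+n j<N)))
... | true = begin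
  #< N p + 1        ≡⟨ +-comm _ 1 ⟩
  suc (#< N p)      ≤⟨ s≤s (#<-injection N M {p} {q′} f
                         (λ j j<N pj → proj₁ (maps j (m<n⇒m<1+n j<N) pj) ,
                           ∧-true (proj₂ (maps j (m<n⇒m<1+n j<N) pj)) (≢⇒not≡ᵇ (inj j N j<N ≤-refl pj eq)))
                         (λ i j i<j j<N → inj i j i<j (m<n⇒m<1+n j<N))) ⟩
  suc (#< M q′)     ≤⟨ #<-strict M (λ j _ q′j → proj₁ (∧-true⁻¹ q′j)) (f N) (proj₁ (maps N ≤-refl eq))
                         q′fN (proj₂ (maps N ≤-refl eq)) ⟩
  #< M q            ∎
  where
  open ≤-Reasoning
  q′ : ℕ → Bool
  q′ j = q j ∧ not (j ≡ᵇ f N)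
  ≢⇒not≡ᵇ : ∀ {m n} → m ≢ n → not (m ≡ᵇ n) ≡ true
  ≢⇒not≡ᵇ {m} {n} m≢n with m ≡ᵇ n in e
  ... | false = refl
  ... | true  = contradiction (≡ᵇ-true⁻¹ e) m≢n
  q′fN : q′ (f N) ≡ false
  q′fN rewrite ≡ᵇ-true (f N) with q (f N)
  ... | false = refl
  ... | true  = refl

bounded-sup : ∀ n {P : ℕ → ℕ → Set} → (∀ j → j < n → ∃ λ β → ∀ x → P j x → x < β) →
  ∃ λ β → ∀ j x → j < n → P j x → x < β
bounded-sup zero bounds = 0 , λ { j x () }
bounded-sup (suc n) {P} bounds
  with β , below ← bounded-sup n (λ j j<n → bounds j (m<n⇒m<1+n j<n))
  with β′ , below′ ← bounds n ≤-refl
  = β ⊔ β′ , λ j x j<1+n Pjx → bound j x (<suc-split j<1+n) Pjx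
  where
  bound : ∀ j x → j < n ⊎ j ≡ n → P j x → x < β ⊔ β′
  bound j x (inj₁ j<n) Pjx = <-≤-trans (below j x j<n Pjx) (m≤m⊔n β β′)
  bound j x (inj₂ refl) Pjx = <-≤-trans (below′ x Pjx) (m≤n⊔m β β′)

module _ (lt : ℕ → ℕ → Bool)
  (irrefl : ∀ x → lt x x ≢ true)
  (transitive : ∀ x y z → lt x y ≡ true → lt y z ≡ true → lt x z ≡ true)
  (total : ∀ x y → x ≡ y ⊎ lt x y ≡ true ⊎ lt y x ≡ true)
  (finite : ∀ x → ∃ λ β → ∀ y → lt y x ≡ true → y < β) where

  private
    β : ℕ → ℕ
    β x = proj₁ (finite x)

    rank : ℕ → ℕ
    rank x = #< (β x) (λ y → lt y x)

    rank-below : ∀ x {M} → β x ≤ M → #< M (λ y → lt y x) ≡ rank x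
    rank-below x βx≤M = #<-extend _ βx≤M λ j βx≤j _ →
      ¬-not λ j<x → <⇒≱ (proj₂ (finite x) j j<x) βx≤j

    rank-mono : ∀ x y → lt x y ≡ true → rank x < rank y
    rank-mono x y x<y = begin-strict
      rank x                   ≡⟨ rank-below x (≤-trans (m≤m⊔n _ _) (m≤m⊔n _ _)) ⟨
      #< M (λ z → lt z x)      <⟨ #<-strict M (λ z _ z<x → transitive z x y z<x x<y) x (m≤n⊔m (β x ⊔ β y) (suc x))
                                    (¬-not (irrefl x)) x<y ⟩
      #< M (λ z → lt z y)      ≡⟨ rank-below y (≤-trans (m≤n⊔m (β x) _) (m≤m⊔n _ _)) ⟩
      rank y                   ∎
      where
      open ≤-Reasoning
      M = (β x ⊔ β y) ⊔ suc x

    rank-reflects : ∀ x y → rank x < rank y → lt x y ≡ true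
    rank-reflects x y rx<ry with total x y
    ... | inj₁ refl = contradiction rx<ry (<-irrefl refl)
    ... | inj₂ (inj₁ x<y) = x<y
    ... | inj₂ (inj₂ y<x) = contradiction (<-trans rx<ry (rank-mono y x y<x)) (<-irrefl refl)

    rank-injective : ∀ {x y} → rank x ≡ rank y → x ≡ y
    rank-injective {x} {y} eq with total x y
    ... | inj₁ x≡y = x≡y
    ... | inj₂ (inj₁ x<y) = contradiction (rank-mono x y x<y) (<-irrefl eq)
    ... | inj₂ (inj₂ y<x) = contradiction (rank-mono y x y<x) (<-irrefl (sym eq))

    rank-unbounded : ∀ n → ∃ λ x → n ≤ rank x
    rank-unbounded zero = 0 , z≤n
    -- The number `β x ⊔ suc x` is too large to precede `x` and differs from `x`, so it lies above
    -- `x`.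
    rank-unbounded (suc n) with x , n≤rx ← rank-unbounded n with total x (β x ⊔ suc x)
    ... | inj₁ x≡y        = contradiction (m≤n⊔m (β x) (suc x)) (<⇒≱ (s≤s (≤-reflexive (sym x≡y))))
    ... | inj₂ (inj₁ x<y) = _ , ≤-<-trans n≤rx (rank-mono x _ x<y)
    ... | inj₂ (inj₂ y<x) = contradiction (proj₂ (finite x) _ y<x) (≤⇒≯ (m≤m⊔n (β x) (suc x)))

    maximum : ∀ M (p : ℕ → Bool) → (∀ z → z < M → p z ≢ true) ⊎
      ∃ λ y → p y ≡ true × (∀ z → z < M → p z ≡ true → lt z y ≡ true ⊎ z ≡ y)
    maximum zero p = inj₁ λ z ()
    maximum (suc M) p with p M in pM | maximum M p
    ... | false | inj₁ none =
      inj₁ (<suc-elim none λ pM′ → contradiction (trans (sym pM) pM′) λ ())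
    ... | false | inj₂ (y , py , max) =
      inj₂ (y , py , <suc-elim max λ pM′ → contradiction (trans (sym pM) pM′) λ ())
    ... | true | inj₁ none =
      inj₂ (M , pM , <suc-elim (λ z z<M pz → contradiction pz (none z z<M)) λ _ → inj₂ refl)
    ... | true | inj₂ (y , py , max) with total M y
    ...   | inj₁ M≡y        = inj₂ (y , py , <suc-elim max λ _ → inj₂ M≡y)
    ...   | inj₂ (inj₁ M<y) = inj₂ (y , py , <suc-elim max λ _ → inj₁ M<y)
    ...   | inj₂ (inj₂ y<M) = inj₂ (M , pM ,
      <suc-elim (λ z z<M pz → inj₁ (below z (max z z<M pz))) λ _ → inj₂ refl)
      where
      below : ∀ z → lt z y ≡ true ⊎ z ≡ y → lt z M ≡ true
      below z (inj₁ z<y)  = transitive z y M z<y y<M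
      below z (inj₂ refl) = y<M

    -- Descent from `x` through immediate predecessors, supplied by `maximum`; each step lowers the
    -- rank by exactly one, so no value is skipped.
    rank-attained : ∀ r n x → rank x ≡ r → n ≤ r → ∃ λ y → rank y ≡ n
    rank-attained zero zero x eq n≤r = x , eq
    rank-attained (suc r) n x eq n≤1+r with m≤n⇒m<n∨m≡n n≤1+r
    ... | inj₂ refl = x , eq
    ... | inj₁ n<1+r with maximum (β x) (λ z → lt z x)
    ...   | inj₁ none = contradiction
      (trans (sym eq) (#<-extend {n = β x} _ z≤n λ z _ z<β → ¬-not (none z z<β))) λ ()
    ...   | inj₂ (y , y<x , max) = rank-attained r n y
      (≤-antisym (s≤s⁻¹ (≤-trans (rank-mono y x y<x) (≤-reflexive eq))) r≤ry) (s≤s⁻¹ n<1+r)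
      where
      open ≤-Reasoning
      M = β x ⊔ β y
      r≤ry : r ≤ rank y
      r≤ry = s≤s⁻¹ (begin
        suc r                        ≡⟨ eq ⟨
        rank x                       ≡⟨ rank-below x (m≤m⊔n _ _) ⟨
        #< M (λ z → lt z x)          ≤⟨ #<-insert M y (λ z _ z<x → max z (proj₂ (finite x) z z<x) z<x) ⟩
        suc (#< M (λ z → lt z y))    ≡⟨ cong suc (rank-below y (m≤n⊔m (β x) _)) ⟩
        suc (rank y)                 ∎)

  omegaType : OmegaType lt
  omegaType = rank , (rank-injective , onto) , λ x y → mk⇔ (rank-mono x y) (rank-reflects x y)
    where
    onto : ∀ n → ∃ λ x → ∀ {z} → z ≡ x → rank z ≡ n
    onto n with x , n≤rx ← rank-unbounded n with y , ry≡n ← rank-attained (rank x) n x refl n≤rx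
      = y , λ { refl → ry≡n }

-- Finiteness of the blocks

module Insertions (out : ℕ → ℕ → Bool) (outᶜ : CompRel out) where

  open Order out outᶜ public

  allowance : ℕ → ℕ
  allowance x = budget root x (root (host x))

  record Insertion (x : ℕ) : Set where
    field
      host<  : host x < x
      color≤ : color x ≤ root (host x)
      low-host : remaining x (host x) ≤ allowance x
      low-rivals : ∀ {z} → z < x → host z ≡ host x → color z ≡ color x → inserted z ≡ true →
        remaining x z ≤ allowance x

  separates-inserted : ∀ x {z} → host z ≡ host x → color z ≡ color x → inserted z ≡ true →
    separates root x z ≡ true
  separates-inserted x {z} h c ins rewrite h | c | ≡ᵇ-true (host x) | ≡ᵇ-true (color x) =
    trans (root<ᵇ z) ins

  insertion : ∀ {x} → inserted x ≡ true → Insertion x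
  insertion {x} ins
    with b<x , adm ← ∧-true⁻¹ (trans (sym (inserted≡ x)) ins)
    with c≤t , adm′ ← ∧-true⁻¹ adm
    with low-b , rivals ← ∧-true⁻¹ adm′
    = record
      { host< = <ᵇ-true⁻¹ b<x
      ; color≤ = s≤s⁻¹ (<ᵇ-true⁻¹ c≤t)
      ; low-host = s≤s⁻¹ (<ᵇ-true⁻¹ low-b)
      ; low-rivals = λ {z} z<x h c insz → s≤s⁻¹ (<ᵇ-true⁻¹ (trans
          (cong (λ s → not s ∨ low x (allowance x) z) (sym (separates-inserted x h c insz)))
          (all<-true⁻¹ x rivals z z<x)))
      }

  inserted≡-rivals : ∀ {x} → host x < x → color x ≤ root (host x) → remaining x (host x) ≤ allowance x →
    (host x <ᵇ x) ∧ admissible x root ≡ all< x (λ z → not (separates root x z) ∨ low x (allowance x) z)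
  inserted≡-rivals b<x c≤t low-b rewrite <ᵇ-true b<x | <ᵇ-true (s≤s c≤t) | <ᵇ-true (s≤s low-b) = refl

  rival : ∀ {x} → inserted x ≡ false → host x < x → color x ≤ root (host x) →
    remaining x (host x) ≤ allowance x →
    ∃ λ z → z < x × host z ≡ host x × color z ≡ color x × inserted z ≡ true ×
      allowance x < remaining x z
  rival {x} ins b<x c≤t low-b
    with z , z<x , fails ← all<-false⁻¹ x
      (trans (sym (inserted≡-rivals b<x c≤t low-b)) (trans (sym (inserted≡ x)) ins))
    with separates root x z in sep
  ... | false = contradiction fails λ ()
  ... | true
    with h , sep′ ← ∧-true⁻¹ sep
    with c , r<z ← ∧-true⁻¹ sep′
    = z , z<x , ≡ᵇ-true⁻¹ h , ≡ᵇ-true⁻¹ c , trans (sym (root<ᵇ z)) r<z , <ᵇ-false⁻¹ fails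

Never : (ℕ → ℕ → Bool) → ℕ → Set
Never p n = ∀ s → p s n ≡ false

-- The limited principle of omniscience for computable predicates.
LPO : Set
LPO = ∀ {p : ℕ → Bool} → CompB {1} (λ v → p (lookup v zero)) →
  (∃ λ s → p s ≡ true) ⊎ (∀ s → p s ≡ false)

module FiniteBlocks
  (out : ℕ → ℕ → Bool) (outᶜ : CompRel out)
  (out-mono : ∀ {s s′ n} → s ≤ s′ → out s n ≡ true → out s′ n ≡ true)
  (lpo : LPO)
  (D-infinite : Infinite (Never out))
  where

  open Insertions out outᶜ public

  -- Contains C, and each of its elements is in C up to double negation.
  D : ℕ → Set
  D = Never out

  D? : ∀ n → (∃ λ s → out s n ≡ true) ⊎ D n
  D? n = lpo (on₂ outᶜ x₀ (constᶜ n))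

  inD : ℕ → Bool
  inD n with D? n
  ... | inj₁ _ = false
  ... | inj₂ _ = true

  inD⇒D : ∀ {n} → inD n ≡ true → D n
  inD⇒D {n} eq with D? n
  ... | inj₂ d = d

  D⇒inD : ∀ {n} → D n → inD n ≡ true
  D⇒inD {n} d with D? n
  ... | inj₂ _ = refl
  ... | inj₁ (s , o) with () ← trans (sym o) (d s)

  inD-or-out : ∀ n → inD n ≡ true ⊎ ∃ λ s → out s n ≡ true
  inD-or-out n with D? n
  ... | inj₁ o = inj₂ o
  ... | inj₂ _ = inj₁ refl

  inD≤remaining : ∀ x b → #< b inD ≤ remaining x b
  inD≤remaining x b = #<-mono b λ j _ inDj → cong not (inD⇒D inDj x)

  remaining-settles : ∀ b → ∃ λ S → ∀ x → S ≤ x → remaining x b ≤ #< b inD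
  remaining-settles zero = 0 , λ x _ → z≤n
  remaining-settles (suc b) with S , settled ← remaining-settles b with inD-or-out b
  ... | inj₁ inDb = S , λ x S≤x → +-mono-≤ (settled x S≤x) (boolToℕ-mono λ _ → inDb)
  ... | inj₂ (s , o) = S ⊔ s , λ x S⊔s≤x → +-mono-≤ (settled x (≤-trans (m≤m⊔n S s) S⊔s≤x))
    (≤-trans (≤-reflexive (cong (λ c → boolToℕ (not c)) (out-mono (≤-trans (m≤n⊔m S s) S⊔s≤x) o))) z≤n)

  inD-unbounded : ∀ k → ∃ λ Q → ∀ b → Q < b → k < #< b inD
  inD-unbounded zero with q , _ , d ← D-infinite 0 = q , λ b q<b → begin-strict
    0                            <⟨ s≤s z≤n ⟩
    1                            ≡⟨ cong boolToℕ (D⇒inD d) ⟨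
    boolToℕ (inD q)              ≤⟨ m≤n+m _ (#< q inD) ⟩
    #< (suc q) inD               ≤⟨ #<-monoˡ inD q<b ⟩
    #< b inD                     ∎
    where open ≤-Reasoning
  inD-unbounded (suc k) with Q , many ← inD-unbounded k with q , Q<q , d ← D-infinite (suc Q) =
    q , λ b q<b → begin-strict
      suc k                      <⟨ s≤s (many q Q<q) ⟩
      suc (#< q inD)             ≡⟨ +-comm 1 _ ⟩
      #< q inD + 1               ≡⟨ cong (λ c → #< q inD + boolToℕ c) (D⇒inD d) ⟨
      #< (suc q) inD             ≤⟨ #<-monoˡ inD q<b ⟩
      #< b inD                   ∎
    where open ≤-Reasoning

  -- Members of `D` never leave, so at no stage can a label with more than `k` of them below it be
  -- low; the bound is therefore uniform in the stage.
  low⇒bounded : ∀ k → ∃ λ Q → ∀ x b → remaining x b ≤ k → b ≤ Q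
  low⇒bounded k with Q , many ← inD-unbounded k =
    Q , λ x b low-b → ≮⇒≥ λ Q<b → <⇒≱ (many b Q<b) (≤-trans (inD≤remaining x b) low-b)

  -- The joint size, up to `x`, of all blocks before `t`: the part of `budget` that varies with the
  -- stage.
  blockSize : ℕ → ℕ → ℕ
  blockSize x t = #< x (λ y → root y <ᵇ t)

  blockSize-stable : ∀ {t β x} → (∀ y → root y < t → y < β) → β ≤ x → blockSize x t ≡ blockSize β t
  blockSize-stable {t} finite β≤x = #<-extend _ β≤x λ j β≤j _ →
    <ᵇ-false (≮⇒≥ λ rj<t → <⇒≱ (finite j rj<t) β≤j)

  module _ {t β} (finite : ∀ y → root y < t → y < β)
    {Q} (bounded : ∀ x b → remaining x b ≤ t + blockSize β t → b ≤ Q) where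

    private
      M : ℕ
      M = Q ⊔ β

    New : ℕ → ℕ → ℕ → Set
    New b d x = M < x × inserted x ≡ true × root x ≡ t × host x ≡ b × color x ≡ d

    newᵇ : ℕ → ℕ → ℕ → Bool
    newᵇ b d x = (M <ᵇ x) ∧ inserted x ∧ (root x ≡ᵇ t) ∧ (host x ≡ᵇ b) ∧ (color x ≡ᵇ d)

    newᵇ⇒New : ∀ b d x → newᵇ b d x ≡ true → New b d x
    newᵇ⇒New b d x eq₀ =
      let M<x , eq₁ = ∧-true⁻¹ eq₀
          ins , eq₂ = ∧-true⁻¹ {inserted x} eq₁
          r   , eq₃ = ∧-true⁻¹ {root x ≡ᵇ t} eq₂
          h   , c   = ∧-true⁻¹ {host x ≡ᵇ b} eq₃
      in <ᵇ-true⁻¹ M<x , ins , ≡ᵇ-true⁻¹ r , ≡ᵇ-true⁻¹ h , ≡ᵇ-true⁻¹ c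

    New⇒newᵇ : ∀ b d x → New b d x → newᵇ b d x ≡ true
    New⇒newᵇ b d x (M<x , ins , refl , refl , refl) =
      ∧-true (<ᵇ-true M<x) (∧-true ins (∧-true (≡ᵇ-true (root x))
        (∧-true (≡ᵇ-true (host x)) (≡ᵇ-true (color x)))))

    allowance≡ : ∀ {x} → M < x → inserted x ≡ true → root x ≡ t → allowance x ≡ t + blockSize β t
    allowance≡ {x} M<x ins rx = trans (cong (budget root x) (trans (sym (root-inserted ins)) rx))
      (cong (t +_) (blockSize-stable finite (≤-trans (m≤n⊔m Q β) (<⇒≤ M<x))))

    -- A label `y` beyond `M` is too large to be low, so as a rival it blocks every later insertion
    -- with the same host and color. After `M` each request is served at most once.
    New-unique : ∀ {b d x y} → New b d x → New b d y → x ≤ y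
    New-unique {x = x} {y} (M<x , ins , rx , h , c) (M<y , insy , ry , hy , cy) = ≮⇒≥ λ y<x →
      <⇒≱ M<y (≤-trans (bounded x y (≤-trans
        (Insertion.low-rivals (insertion ins) y<x (trans hy (sym h)) (trans cy (sym c)) insy)
        (≤-reflexive (allowance≡ M<x ins rx)))) (m≤m⊔n Q β))

    New-bounded : ∀ b d → ∃ λ γ → ∀ x → New b d x → x < γ
    -- Uniqueness becomes a bound once it is decided whether the one possible insertion ever
    -- happens.
    New-bounded b d with lpo {newᵇ b d}
      (constᶜ M <ᶜ x₀ ∧ᶜ insertedᶜ x₀ ∧ᶜ rootᶜ x₀ ≡ᶜ constᶜ t ∧ᶜ hostᶜ x₀ ≡ᶜ constᶜ b ∧ᶜ colorᶜ x₀ ≡ᶜ constᶜ d)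
    ... | inj₁ (y , eq) = suc y , λ x nx → s≤s (New-unique nx (newᵇ⇒New b d y eq))
    ... | inj₂ none = 0 , λ x nx → contradiction (trans (sym (New⇒newᵇ b d x nx)) (none x)) λ ()

    New-host : ∀ {x} → M < x → inserted x ≡ true → root x ≡ t → host x ≤ Q
    New-host {x} M<x ins rx = bounded x (host x)
      (≤-trans (Insertion.low-host (insertion ins)) (≤-reflexive (allowance≡ M<x ins rx)))

    New-color : ∀ {x} → inserted x ≡ true → root x ≡ t → color x ≤ t
    New-color ins rx = ≤-trans (Insertion.color≤ (insertion ins))
      (≤-reflexive (trans (sym (root-inserted ins)) rx))

    -- Only finitely many pairs of a host at most `Q` and a color at most `t` can occur, and each
    -- pair has its own bound.
    insertions-bounded : ∃ λ γ → ∀ x → M < x → inserted x ≡ true → root x ≡ t → x < γ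
    insertions-bounded =
      let γ , below = bounded-sup (suc Q) {λ b x → ∃ λ d → d < suc t × New b d x} λ b _ →
            let γ , below = bounded-sup (suc t) {λ d x → New b d x} (λ d _ → New-bounded b d)
            in γ , λ { x (d , d≤t , nx) → below d x d≤t nx }
      in γ , λ x M<x ins rx → below (host x) x (s≤s (New-host M<x ins rx))
        (color x , s≤s (New-color ins rx) , M<x , ins , rx , refl , refl)

    block-bound : ∀ γ → (∀ x → M < x → inserted x ≡ true → root x ≡ t → x < γ) →
      ∀ y → root y < suc t → y < suc t ⊔ (suc M ⊔ γ)
    block-bound γ below y ry≤t with <suc-split ry≤t
    ... | inj₁ ry<t = <-≤-trans (finite y ry<t) (≤-trans (≤-trans (m≤n⊔m Q β) (n≤1+n M))
      (≤-trans (m≤m⊔n (suc M) γ) (m≤n⊔m (suc t) (suc M ⊔ γ))))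
    ... | inj₂ ry≡t with inserted y in ins
    ...   | false = <-≤-trans (s≤s (≤-reflexive (trans (sym (root-top ins)) ry≡t))) (m≤m⊔n (suc t) (suc M ⊔ γ))
    ...   | true with M <? y
    ...     | no M≮y = <-≤-trans (s≤s (≮⇒≥ M≮y)) (≤-trans (m≤m⊔n (suc M) γ) (m≤n⊔m (suc t) (suc M ⊔ γ)))
    ...     | yes M<y = <-≤-trans (below y M<y ins ry≡t) (≤-trans (m≤n⊔m (suc M) γ) (m≤n⊔m (suc t) (suc M ⊔ γ)))

  -- Induction on `t`: past a bound `β` of the earlier blocks, the budget of block `t` is the
  -- constant `t + blockSize β t`, and since `D` is infinite, only finitely many labels are ever low
  -- for it.
  blocks-finite : ∀ t → ∃ λ β → ∀ y → root y < t → y < β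
  blocks-finite zero = 0 , λ y ()
  blocks-finite (suc t) =
    let β , finite  = blocks-finite t
        Q , bounded = low⇒bounded (t + blockSize β t)
        γ , below   = insertions-bounded finite bounded
    in suc t ⊔ (suc (Q ⊔ β) ⊔ γ) , block-bound finite bounded γ below

  -- Separation of low labels by each permitted color

  -- If `x` is inserted, it lies between `a` and the host itself. If it is refused, a rival that is
  -- not low does so, being younger than the low label `a`.
  separated : ∀ {x a} → host x < x → color x ≤ root (host x) → remaining x (host x) ≤ allowance x →
    a < x → remaining x a ≤ allowance x → a ≺ host x →
    ∃ λ z → a ≺ z × z ≺ host x × color z ≡ color x
  separated {x} {a} b<x c≤t low-b a<x low-a a≺b with inserted x in ins
  ... | true = x , ≺-before-host ins a<x a≺b , ≺-host ins , refl
  ... | false with z , z<x , hz , cz , insz , high-z ← rival ins b<x c≤t low-b =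
    z , ≺-before-host insz a<z (subst (a ≺_) (sym hz) a≺b) , subst (z ≺_) hz (≺-host insz) , cz
    where
    a<z : a < z
    a<z = ≰⇒> λ z≤a → <⇒≱ high-z (≤-trans (#<-monoˡ _ z≤a) low-a)

  dense : ∀ {t β} → (∀ y → root y < t → y < β) → ∀ {a b d} → a ≺ b → t ≤ root b → d ≤ root b →
    #< a inD ≤ t + blockSize β t → #< b inD ≤ t + blockSize β t →
    ∃ λ z → a ≺ z × z ≺ b × color z ≡ d
  dense {t} {β} finite {a} {b} {d} a≺b t≤rb d≤rb few-a few-b
    with Sa , settled-a ← remaining-settles a
    with Sb , settled-b ← remaining-settles b
    = z
    where
    w x : ℕ
    -- The serial number `w` forces `x` past the stages at which `remaining` settles for `a` and
    -- `b`, past all labels with root below `t`, and past `a` and `b` themselves.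
    w = (Sa ⊔ Sb) ⊔ (β ⊔ (suc a ⊔ suc b))
    x = pair b (pair d w)
    w≤x : w ≤ x
    w≤x = ≤-trans (≤-pairʳ d w) (≤-pairʳ b (pair d w))
    S≤x : Sa ⊔ Sb ≤ x
    S≤x = ≤-trans (m≤m⊔n _ _) w≤x
    rest≤x : β ⊔ (suc a ⊔ suc b) ≤ x
    rest≤x = ≤-trans (m≤n⊔m (Sa ⊔ Sb) _) w≤x
    a⊔b≤x : suc a ⊔ suc b ≤ x
    a⊔b≤x = ≤-trans (m≤n⊔m β _) rest≤x
    hx : host x ≡ b
    hx = fst-pair b (pair d w)
    cx : color x ≡ d
    cx = trans (cong fst (snd-pair b (pair d w))) (fst-pair d w)
    k≤ : t + blockSize β t ≤ allowance x
    k≤ = begin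
      t + blockSize β t                      ≤⟨ +-mono-≤ t≤rb (#<-monoˡ _ (≤-trans (m≤m⊔n β _) rest≤x)) ⟩
      root b + blockSize x t                 ≤⟨ +-monoʳ-≤ (root b) (#<-mono x λ y _ ry<t →
                                                  <ᵇ-true (<-≤-trans (<ᵇ-true⁻¹ ry<t) t≤rb)) ⟩
      root b + blockSize x (root b)          ≡⟨ cong (λ c → root c + blockSize x (root c)) hx ⟨
      allowance x                            ∎
      where open ≤-Reasoning
    found : ∃ λ z → a ≺ z × z ≺ host x × color z ≡ color x
    found = separated
      (subst (_< x) (sym hx) (≤-trans (m≤n⊔m (suc a) (suc b)) a⊔b≤x))
      (subst₂ (λ c h → c ≤ root h) (sym cx) (sym hx) d≤rb)
      (subst (λ h → remaining x h ≤ allowance x) (sym hx)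
        (≤-trans (settled-b x (≤-trans (m≤n⊔m Sa Sb) S≤x)) (≤-trans few-b k≤)))
      (≤-trans (m≤m⊔n (suc a) (suc b)) a⊔b≤x)
      (≤-trans (settled-a x (≤-trans (m≤m⊔n Sa Sb) S≤x)) (≤-trans few-a k≤))
      (subst (a ≺_) (sym hx) a≺b)
    z : ∃ λ z → a ≺ z × z ≺ b × color z ≡ d
    z = subst₂ (λ h c → ∃ λ z → a ≺ z × z ≺ h × color z ≡ c) hx cx found

  lt-omegaType : OmegaType lt
  lt-omegaType = omegaType lt (λ x x≺x → ≺-irrefl {x} (lt⇒≺ x≺x))
    (λ x y z x≺y y≺z → ≺⇒lt {x} {z} (≺-trans {x} {y} {z} (lt⇒≺ x≺y) (lt⇒≺ y≺z))) total finite
    where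
    total : ∀ x y → x ≡ y ⊎ lt x y ≡ true ⊎ lt y x ≡ true
    total x y with ≺-total x y
    ... | inj₁ x≡y = inj₁ x≡y
    ... | inj₂ (inj₁ x≺y) = inj₂ (inj₁ (≺⇒lt {x} {y} x≺y))
    ... | inj₂ (inj₂ y≺x) = inj₂ (inj₂ (≺⇒lt {y} {x} y≺x))
    finite : ∀ x → ∃ λ β → ∀ y → lt y x ≡ true → y < β
    finite x =
      let β , below = blocks-finite (suc (root x))
      in β , λ y y≺x → below y (s≤s (≮⇒≥ λ rx<ry →
        ≺-irrefl {x} (≺-trans {x} {y} {x} (root<⇒≺ {x} {y} rx<ry) (lt⇒≺ y≺x))))

-- Sparsity of cohesive sets

≤-∑< : ∀ f {j n} → j < n → f j ≤ ∑< n f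
≤-∑< f {j} {suc n} j<1+n with <suc-split j<1+n
... | inj₁ j<n  = ≤-trans (≤-∑< f j<n) (m≤m+n _ _)
... | inj₂ refl = m≤n+m _ (∑< n f)

#<-attained : ∀ p M k → k ≤ #< M p → ∃ λ N → #< N p ≡ k
#<-attained p zero k k≤0 = 0 , sym (n≤0⇒n≡0 k≤0)
#<-attained p (suc M) k k≤ with k ≤? #< M p
... | yes k≤′ = #<-attained p M k k≤′
... | no k≰ = suc M , ≤-antisym (≤-trans (+-monoʳ-≤ (#< M p) (boolToℕ≤1 (p M)))
    (≤-trans (≤-reflexive (+-comm _ 1)) (≰⇒> k≰))) k≤
  where
  boolToℕ≤1 : ∀ b → boolToℕ b ≤ 1
  boolToℕ≤1 false = z≤n
  boolToℕ≤1 true  = ≤-refl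

#<-discard : ∀ n₀ n p → #< n p ≤ n₀ + #< n (λ j → p j ∧ (n₀ <ᵇ suc j))
#<-discard n₀ n p with ≤-total n n₀
... | inj₁ n≤n₀ = ≤-trans (#<-≤ n p) (≤-trans n≤n₀ (m≤m+n n₀ _))
... | inj₂ n₀≤n = go (≤⇒≤′ n₀≤n)
  where
  go : ∀ {n} → n₀ ≤′ n → #< n p ≤ n₀ + #< n (λ j → p j ∧ (n₀ <ᵇ suc j))
  go ≤′-refl = ≤-trans (#<-≤ n₀ p) (m≤m+n n₀ _)
  go (≤′-step {n} n₀≤n) = ≤-trans (+-mono-≤ (go n₀≤n)
    (boolToℕ-mono λ pn → ∧-true pn (<ᵇ-true (s≤s (≤′⇒≤ n₀≤n)))))
    (≤-reflexive (+-assoc n₀ _ _))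

even : ℕ → Bool
even zero    = true
even (suc n) = not (even n)

evenᶜ : ∀ {n} {f : Vec ℕ n → ℕ} → Comp f → CompB (λ v → even (f v))
evenᶜ {n} {f} cf .CompB.toComp = ext (primrecᶜ (constᶜ 1) (constᶜ 1 ∸ᶜ x₁) cf) λ v → lem v (f v)
  where
  not-∸ : ∀ b → 1 ∸ boolToℕ b ≡ boolToℕ (not b)
  not-∸ false = refl
  not-∸ true  = refl
  lem : ∀ (v : Vec ℕ n) k → primrec (λ _ → 1) (λ w → 1 ∸ lookup w (suc zero)) k v ≡ boolToℕ (even k)
  lem v zero = refl
  lem v (suc k) = trans (cong (1 ∸_) (lem v k)) (not-∸ (even k))

-- The intervals [start j , start (1 + j)) partition ℕ.
module Blocks (f : ℕ → ℕ) where

  -- Each new start exceeds `f q` for all `q` up to the previous one, so a step from some `q` before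
  -- a block to a number at most `f q` cannot jump over that block.
  start : ℕ → ℕ
  start zero    = 0
  start (suc j) = suc (start j + ∑< (suc (start j)) f)

  block : ℕ → ℕ
  block zero    = 0
  block (suc n) = if start (suc (block n)) <ᵇ suc (suc n) then suc (block n) else block n

  start-< : ∀ j → start j < start (suc j)
  start-< j = s≤s (m≤m+n (start j) _)

  start-mono : ∀ {i j} → i ≤ j → start i ≤ start j
  start-mono i≤j = go (≤⇒≤′ i≤j)
    where
    go : ∀ {i j} → i ≤′ j → start i ≤ start j
    go ≤′-refl = ≤-refl
    go (≤′-step {j} i≤j) = ≤-trans (go i≤j) (<⇒≤ (start-< j))

  ≤-start : ∀ j → j ≤ start j
  ≤-start zero    = z≤n
  ≤-start (suc j) = ≤-<-trans (≤-start j) (start-< j)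

  start-bound : ∀ j {q} → q < start j → f q < start (suc j)
  start-bound j q<x = s≤s (≤-trans (≤-∑< f (m<n⇒m<1+n q<x)) (m≤n+m _ (start j)))

  block-spec : ∀ n → start (block n) ≤ n × n < start (suc (block n))
  block-spec zero = z≤n , s≤s z≤n
  block-spec (suc n) with block-spec n | start (suc (block n)) <ᵇ suc (suc n) in eq
  ... | lower , upper | false = m≤n⇒m≤1+n lower , s≤s⁻¹ (s≤s (<ᵇ-false⁻¹ eq))
  ... | lower , upper | true  = s≤s⁻¹ (<ᵇ-true⁻¹ eq) , ≤-<-trans upper (start-< (suc (block n)))

  block-unique : ∀ {j n} → start j ≤ n → n < start (suc j) → block n ≡ j
  block-unique {j} {n} lower upper with block-spec n
  ... | lower′ , upper′ = ≤-antisym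
    (≮⇒≥ λ j<b → <⇒≱ upper (≤-trans (start-mono j<b) lower′))
    (≮⇒≥ λ b<j → <⇒≱ upper′ (≤-trans (start-mono b<j) lower))

  module _ (cf : Comp₁ f) where

    startᶜ : Comp₁ start
    startᶜ .Comp₁.toComp₁ = ext (primrec₀ᶜ {f = λ _ → 0} (constᶜ 0) (sucᶜ (x₁ +ᶜ ∑<ᶜ (sucᶜ x₁) (cf · x₀))))
      λ { (j ∷ []) → lem j }
      where
      lem : ∀ j → primrec {0} (λ _ → 0)
        (λ w → suc (lookup w (suc zero) + ∑< (suc (lookup w (suc zero))) f)) j [] ≡ start j
      lem zero = refl
      lem (suc j) rewrite lem j = refl

    blockᶜ : Comp₁ block
    blockᶜ .Comp₁.toComp₁ = ext (primrec₀ᶜ {f = λ _ → 0} (constᶜ 0)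
      (ifᶜ (startᶜ · sucᶜ x₁ <ᶜ sucᶜ (sucᶜ x₀)) (sucᶜ x₁) x₁)) λ { (n ∷ []) → lem n }
      where
      lem : ∀ n → primrec {0} (λ _ → 0)
        (λ w → if start (suc (lookup w (suc zero))) <ᵇ suc (suc (lookup w zero))
          then suc (lookup w (suc zero)) else lookup w (suc zero)) n [] ≡ block n
      lem zero = refl
      lem (suc n) rewrite lem n = refl

-- Cohesiveness with c.e. sets given by computable predicates of a stage `s` and a number `n`.
Dichotomy : (ℕ → Set) → Set
Dichotomy X = ∀ {p} → CompRel p → (X ⊆* λ n → ∃ λ s → p s n ≡ true) ⊎ (X ⊆* Never p)

module Sparsity
  (out : ℕ → ℕ → Bool) (outᶜ : CompRel out)
  (out-mono : ∀ {s s′ n} → s ≤ s′ → out s n ≡ true → out s′ n ≡ true)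
  (lpo : LPO)
  (D-infinite : Infinite (Never out))
  (D-dichotomy : Dichotomy (Never out))
  where

  open FiniteBlocks out outᶜ out-mono lpo D-infinite public

  infixr 6 _∩_
  _∩_ : ∀ {X P Q : ℕ → Set} → X ⊆* P → X ⊆* Q → X ⊆* λ n → P n × Q n
  (m , p) ∩ (m′ , q) = m ⊔ m′ , λ n le dn → p n (m⊔n≤o⇒m≤o m m′ le) dn , q n (m⊔n≤o⇒n≤o m m′ le) dn

  Diverges : (ℕ → ℕ) → Set
  Diverges f = ∀ M → D ⊆* λ n → M ≤ f n

  find-member : ∀ B (R : ℕ → Bool) → (∃ λ j → j < B × R j ≡ true × D j) ⊎
    ∃ λ s → all< B (λ j → not (R j) ∨ out s j) ≡ true
  find-member zero R = inj₂ (0 , refl)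
  find-member (suc B) R with find-member B R
  ... | inj₁ (j , j<B , Rj , dj) = inj₁ (j , m<n⇒m<1+n j<B , Rj , dj)
  ... | inj₂ (s , all) with R B in RB
  ...   | false = inj₂ (s , ∧-true all refl)
  ...   | true with D? B
  ...     | inj₂ dB = inj₁ (B , ≤-refl , RB , dB)
  ...     | inj₁ (s′ , o) = inj₂ (s ⊔ s′ , ∧-true
    (all<-true B λ j j<B → later (R j) (all<-true⁻¹ B all j j<B))
    (out-mono (m≤n⊔m s s′) o))
    where
    later : ∀ r {j} → not r ∨ out s j ≡ true → not r ∨ out (s ⊔ s′) j ≡ true
    later false _ = refl
    later true o = out-mono (m≤m⊔n s s′) o

  -- That every `j < B n` with `R n j` has been seen to leave is a c.e. event in `n`, so
  -- `D-dichotomy` applies; `find-member` turns failure at all stages into an actual member of `D`.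
  dichotomy : ∀ {B : ℕ → ℕ} {R : ℕ → ℕ → Bool} → Comp₁ B → CompRel R →
    (D ⊆* λ n → ∀ j → j < B n → R n j ≡ true → ¬ D j) ⊎
    D ⊆* λ n → ∃ λ j → j < B n × R n j ≡ true × D j
  dichotomy {B} {R} cB cR with D-dichotomy {λ s n → all< (B n) (λ j → not (R n j) ∨ out s j)}
    (mkCompRel (all<ᶜ (cB · x₁) (notᶜ (on₂ cR x₂ x₀) ∨ᶜ on₂ outᶜ x₁ x₀)))
  ... | inj₁ (m , ev) = inj₁ (m , λ n m≤n dn j j<B Rj dj →
    let s , all = ev n m≤n dn in
    contradiction (trans (sym (dj s))
      (trans (cong (λ r → not r ∨ out s j) (sym Rj)) (all<-true⁻¹ (B n) all j j<B))) λ ())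
  ... | inj₂ (m , ev) = inj₂ (m , λ n m≤n dn → case n (ev n m≤n dn) (find-member (B n) (R n)))
    where
    case : ∀ n → (∀ s → all< (B n) (λ j → not (R n j) ∨ out s j) ≡ false) →
      ((∃ λ j → j < B n × R n j ≡ true × D j) ⊎ ∃ λ s → all< (B n) (λ j → not (R n j) ∨ out s j) ≡ true) →
      ∃ λ j → j < B n × R n j ≡ true × D j
    case n none (inj₁ found) = found
    case n none (inj₂ (s , all)) = contradiction (trans (sym all) (none s)) λ ()

  -- Otherwise almost every member of `D` shares its value with a smaller member. Descending along
  -- these leads below `m`, so every value of `f` on `D` would be at most `∑< m f`, against
  -- divergence.
  diverging-injective : ∀ {f} → Comp₁ f → Diverges f → D ⊆* λ n → ∀ j → j < n → D j → f j ≢ f n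
  diverging-injective {f} cf div
    with dichotomy {λ n → n} {λ n j → f j ≡ᵇ f n} (mkComp₁ x₀) (mkCompRel (cf · x₁ ≡ᶜ cf · x₀))
  ... | inj₁ (m , ev) = m , λ n m≤n dn j j<n dj fj≡fn →
    ev n m≤n dn j j<n (trans (cong (_≡ᵇ f n) fj≡fn) (≡ᵇ-true (f n))) dj
  ... | inj₂ (m , ev)
    with m′ , large ← div (suc (∑< m f))
    with n , m′≤n , dn ← D-infinite m′
    = contradiction (large n m′≤n dn) (<-rec _ descend n dn)
    where
    descend : ∀ n → (∀ {j} → j < n → D j → ¬ ∑< m f < f j) → D n → ¬ ∑< m f < f n
    descend n rec dn big with n <? m
    ... | yes n<m = <⇒≱ big (≤-∑< f n<m)
    ... | no n≮m with j , j<n , fj≡fn , dj ← ev n (≮⇒≥ n≮m) dn =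
      rec j<n dj (subst (∑< m f <_) (sym (≡ᵇ-true⁻¹ fj≡fn)) big)

  last-member : ∀ N m → (∃ λ q → m ≤ q × q < N × D q) →
    ∃ λ q → m ≤ q × q < N × D q × (∀ j → q < j → j < N → ¬ D j)
  last-member zero m (q , _ , () , _)
  last-member (suc N) m (q , m≤q , q<1+N , dq) with D? N | m ≤? N
  ... | inj₂ dN | yes m≤N = N , m≤N , ≤-refl , dN , λ j N<j j<1+N _ → <⇒≱ N<j (s≤s⁻¹ j<1+N)
  ... | inj₂ dN | no m≰N = contradiction (≤-trans m≤q (s≤s⁻¹ q<1+N)) m≰N
  ... | inj₁ (s , o) | _ with <suc-split q<1+N
  ...   | inj₂ refl = contradiction (trans (sym o) (dq s)) λ ()
  ...   | inj₁ q<N with q′ , m≤q′ , q′<N , dq′ , last ← last-member N m (q , m≤q , q<N , dq) =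
    q′ , m≤q′ , m<n⇒m<1+n q′<N , dq′ , λ j q′<j j<1+N dj → above j q′<j dj (<suc-split j<1+N)
    where
    above : ∀ j → q′ < j → D j → ¬ (j < N ⊎ j ≡ N)
    above j q′<j dj (inj₁ j<N) = last j q′<j j<N dj
    above j q′<j dj (inj₂ refl) = contradiction (trans (sym o) (dj s)) λ ()

  module _ {f} (cf : Comp₁ f) m (close : ∀ n → m ≤ n → D n → ∃ λ j → n < j × j ≤ f n × D j) where

    open Blocks f

    -- Take the last member of `D` before the block. The further member promised by `close` is not
    -- before the block by this choice, and not after it by the growth of `start`.
    member-in-block : ∀ {q i} → m ≤ q → D q → q < start i → ∃ λ n → start i ≤ n × D n × block n ≡ i
    member-in-block {q} {i} m≤q dq q<x
      with q′ , m≤q′ , q′<x , dq′ , last ← last-member (start i) m (q , m≤q , q<x , dq)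
      with j , q′<j , j≤f , dj ← close q′ m≤q′ dq′
      = j , x≤j , dj , block-unique x≤j (≤-<-trans j≤f (start-bound i q′<x))
      where
      x≤j : start i ≤ j
      x≤j = ≮⇒≥ λ j<x → last j q′<j j<x dj

    -- Every late block meets D, so the union of the blocks of even index would split D.
    close-impossible : ⊥
    close-impossible
      with q , m≤q , dq ← D-infinite m
      with D-dichotomy {λ s n → even (block n)} (mkCompRel (evenᶜ (blockᶜ cf · x₁)))
    ... | inj₁ (m′ , ev) = contradiction
      (trans (sym (parity-late (suc i) (n≤1+n i))) (cong not (parity-late i ≤-refl))) λ ()
      where
      i = m′ ⊔ suc q
      parity-late : ∀ j → i ≤ j → even j ≡ true
      parity-late j i≤j with n , x≤n , dn , refl ← member-in-block m≤q dq
          (≤-trans (m≤n⊔m m′ (suc q)) (≤-trans i≤j (≤-start j)))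
        = proj₂ (ev n (≤-trans (m≤m⊔n m′ (suc q)) (≤-trans i≤j (≤-trans (≤-start j) x≤n))) dn)
    ... | inj₂ (m′ , ev) = contradiction
      (trans (sym (parity-late (suc i) (n≤1+n i))) (cong not (parity-late i ≤-refl))) λ ()
      where
      i = m′ ⊔ suc q
      parity-late : ∀ j → i ≤ j → even j ≡ false
      parity-late j i≤j with n , x≤n , dn , refl ← member-in-block m≤q dq
          (≤-trans (m≤n⊔m m′ (suc q)) (≤-trans i≤j (≤-start j)))
        = ev n (≤-trans (m≤m⊔n m′ (suc q)) (≤-trans i≤j (≤-trans (≤-start j) x≤n))) dn 0

  -- In the other case of `dichotomy`, almost every member `n` of `D` is followed by another one at
  -- most `f n`, which `close-impossible` refutes.
  gaps : ∀ {f} → Comp₁ f → D ⊆* λ n → ∀ j → D j → n < j → f n < j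
  gaps {f} cf
    with dichotomy {λ n → suc (f n)} {λ n j → n <ᵇ j} (mkComp₁ (sucᶜ (cf · x₀))) (mkCompRel (x₀ <ᶜ x₁))
  ... | inj₁ (m , ev) = m , λ n m≤n dn j dj n<j → ≰⇒> λ j≤fn → ev n m≤n dn j (s≤s j≤fn) (<ᵇ-true n<j) dj
  ... | inj₂ (m , ev) = ⊥-elim (close-impossible cf m λ n m≤n dn →
    let j , j≤fn , n<j , dj = ev n m≤n dn in j , <ᵇ-true⁻¹ n<j , s≤s⁻¹ j≤fn , dj)

  -- Labels of a prescribed color between two functions

  module _ (f g e : ℕ → ℕ) where

    Between : ℕ → ℕ → Set
    Between n z = g n ≺ z × z ≺ f n × color z ≡ e n

    between : ℕ → ℕ → Bool
    between z n = lt (g n) z ∧ lt z (f n) ∧ (color z ≡ᵇ e n)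

    between⇒Between : ∀ z n → between z n ≡ true → Between n z
    between⇒Between z n eq₀ =
      let gz , eq₁ = ∧-true⁻¹ {lt (g n) z} eq₀
          zf , c   = ∧-true⁻¹ {lt z (f n)} eq₁
      in lt⇒≺ gz , lt⇒≺ zf , ≡ᵇ-true⁻¹ c

    Between⇒between : ∀ z n → Between n z → between z n ≡ true
    Between⇒between z n (gz , zf , c) = ∧-true (≺⇒lt gz) (∧-true (≺⇒lt zf)
      (trans (cong (_≡ᵇ e n) c) (≡ᵇ-true (e n))))

    betweenᶜ : Comp₁ f → Comp₁ g → Comp₁ e → CompRel between
    betweenᶜ cf cg ce = mkCompRel (ltᶜ (cg · x₁) x₀ ∧ᶜ ltᶜ x₀ (cf · x₁) ∧ᶜ colorᶜ x₀ ≡ᶜ ce · x₁)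

  module _ {f g e : ℕ → ℕ} (cf : Comp₁ f) (cg : Comp₁ g) (ce : Comp₁ e) (f-div : Diverges f)
    {t₀} (e≤ : ∀ n → t₀ ≤ root (f n) → e n ≤ root (f n)) (g≺f : D ⊆* λ n → g n ≺ f n) where

    module _ {n₀} (f-inj : ∀ n → n₀ ≤ n → D n → ∀ j → j < n → D j → f j ≢ f n)
      (f-gap : ∀ n → n₀ ≤ n → D n → ∀ j → D j → n < j → f n < j)
      (g-gap : ∀ n → n₀ ≤ n → D n → ∀ j → D j → n < j → g n < j)
      (g≺f′ : ∀ n → n₀ ≤ n → D n → g n ≺ f n)
      where

      -- No member of `D` lies strictly between `n` and `h n`, so there are at most as many below
      -- `h n` as up to and including `n`.
      few-below : ∀ {h : ℕ → ℕ} → (∀ n → n₀ ≤ n → D n → ∀ j → D j → n < j → h n < j) →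
        ∀ {n N} → n₀ ≤ n → D n → n < N → #< (h n) inD ≤ #< N inD
      few-below {h} gap {n} {N} n₀≤n dn n<N with ≤-total (h n) (suc n)
      ... | inj₁ hn≤1+n = #<-monoˡ inD (≤-trans hn≤1+n n<N)
      ... | inj₂ 1+n≤hn = ≤-trans (≤-reflexive (#<-extend inD 1+n≤hn empty)) (#<-monoˡ inD n<N)
        where
        empty : ∀ j → n < j → j < h n → inD j ≡ false
        empty j n<j j<hn with inD j in eq
        ... | false = refl
        ... | true  = contradiction (gap n n₀≤n dn j (inD⇒D eq) n<j) (<-asym j<hn)

      module _ {t β} (n₀<t : n₀ < t) (finite : ∀ y → root y < t → y < β) where

        candidate : ℕ → Bool
        candidate n = inD n ∧ (n₀ <ᵇ suc n)

        candidate⁻¹ : ∀ {n} → candidate n ≡ true → D n × n₀ ≤ n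
        candidate⁻¹ {n} eq = let d , l = ∧-true⁻¹ {inD n} eq in inD⇒D d , s≤s⁻¹ (<ᵇ-true⁻¹ l)

        -- f is injective on the candidates, and fewer labels than candidates have a root below t.
        high-candidate : ∀ {N} → #< N inD ≡ t + blockSize β t →
          ∃ λ n → n < N × D n × n₀ ≤ n × t ≤ root (f n)
        high-candidate {N} eq with all< N (λ n → not (candidate n) ∨ (root (f n) <ᵇ t)) in all
        ... | false with n , n<N , high ← all<-false⁻¹ N all with candidate n in cand
        ...   | true = let dn , n₀≤n = candidate⁻¹ {n} cand in n , n<N , dn , n₀≤n , <ᵇ-false⁻¹ high
        ...   | false = contradiction high λ ()
        high-candidate {N} eq | true = contradiction n₀<t (≤⇒≯ (+-cancelʳ-≤ (blockSize β t) t n₀ (begin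
          t + blockSize β t          ≡⟨ eq ⟨
          #< N inD                   ≤⟨ #<-discard n₀ N inD ⟩
          n₀ + #< N candidate        ≤⟨ +-monoʳ-≤ n₀ (#<-injection N β {candidate} {λ y → root y <ᵇ t} f maps inj) ⟩
          n₀ + blockSize β t         ∎)))
          where
          open ≤-Reasoning
          low-root : ∀ j → j < N → candidate j ≡ true → (root (f j) <ᵇ t) ≡ true
          low-root j j<N cand = trans (cong (λ c → not c ∨ (root (f j) <ᵇ t)) (sym cand))
            (all<-true⁻¹ N all j j<N)
          maps : ∀ j → j < N → candidate j ≡ true → f j < β × (root (f j) <ᵇ t) ≡ true
          maps j j<N cand = finite (f j) (<ᵇ-true⁻¹ (low-root j j<N cand)) , low-root j j<N cand
          inj : ∀ i j → i < j → j < N → candidate i ≡ true → candidate j ≡ true → f i ≢ f j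
          inj i j i<j _ candi candj =
            let dj , n₀≤j = candidate⁻¹ {j} candj in f-inj j n₀≤j dj i i<j (proj₁ (candidate⁻¹ {i} candi))

      somewhere-between : ∃ λ n → n₀ ≤ n × D n × ∃ (Between f g e n)
      somewhere-between =
        -- Above `n₀` for the pigeonhole argument, and above `t₀` so that the color `e n` is
        -- permitted in the block reached.
        let t = suc (n₀ + t₀)
            β , finite = blocks-finite t
            k = t + blockSize β t
            Q , many = inD-unbounded k
            -- Exactly `k` members of `D` lie below `N`, as many as `dense` tolerates below its two
            -- labels.
            N , eq = #<-attained inD (suc Q) k (<⇒≤ (many (suc Q) ≤-refl))
            n , n<N , dn , n₀≤n , t≤r = high-candidate (s≤s (m≤m+n n₀ t₀)) finite {N} eq
        in n , n₀≤n , dn ,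
          dense finite (g≺f′ n n₀≤n dn) t≤r (e≤ n (≤-trans (≤-trans (m≤n+m t₀ n₀) (n≤1+n _)) t≤r))
            (≤-trans (few-below g-gap {N = N} n₀≤n dn n<N) (≤-reflexive eq))
            (≤-trans (few-below f-gap {N = N} n₀≤n dn n<N) (≤-reflexive eq))

    not-eventually-empty : ∀ m → ¬ (∀ n → m ≤ n → D n → ∀ z → between f g e z n ≡ false)
    not-eventually-empty m none =
      let n₀ , all = (m , none) ∩ diverging-injective cf f-div ∩ gaps cf ∩ gaps cg ∩ g≺f
          n , n₀≤n , dn , z , bz = somewhere-between {n₀}
            (λ n n₀≤n dn → proj₁ (proj₂ (all n n₀≤n dn)))
            (λ n n₀≤n dn → proj₁ (proj₂ (proj₂ (all n n₀≤n dn))))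
            (λ n n₀≤n dn → proj₁ (proj₂ (proj₂ (proj₂ (all n n₀≤n dn)))))
            (λ n n₀≤n dn → proj₂ (proj₂ (proj₂ (proj₂ (all n n₀≤n dn)))))
      in contradiction (trans (sym (Between⇒between f g e z n bz)) (proj₁ (all n n₀≤n dn) z)) λ ()

    -- A single suitable `n` beyond any given bound rules out the empty alternative, and the
    -- dichotomy spreads existence to almost all of `D`.
    eventually-between : D ⊆* λ n → ∃ λ z → between f g e z n ≡ true
    eventually-between with D-dichotomy (betweenᶜ f g e cf cg ce)
    ... | inj₁ ev         = ev
    ... | inj₂ (m , none) = ⊥-elim (not-eventually-empty m none)

-- The cohesive power

halted : PR 1 → ℕ → ℕ → Bool
halted e s n = 0 <ᵇ encode (eval s e (n ∷ []))

haltedᶜ : ∀ e → CompRel (halted e)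
haltedᶜ e = mkCompRel (constᶜ 0 <ᶜ clock e ∘ᶜ (x₀ ∷ᶜ x₁ ∷ᶜ []ᶜ))

halted⇒≃ : ∀ e s n → halted e s n ≡ true → e ⟨ n ⟩≃ pred (encode (eval s e (n ∷ [])))
halted⇒≃ e s n eq with eval s e (n ∷ []) in ev
... | just y = s , ev

↓⇒halted : ∀ e {n} → e ⟨ n ⟩↓ → ∃ λ s → halted e s n ≡ true
↓⇒halted e (y , s , ev) = s , cong (λ r → 0 <ᵇ encode r) ev

halted-mono : ∀ e {s s′ n} → s ≤ s′ → halted e s n ≡ true → halted e s′ n ≡ true
halted-mono e {s} {n = n} s≤s′ eq with eval s e (n ∷ []) in ev
... | just y = cong (λ r → 0 <ᵇ encode r) (eval-mono e s≤s′ ev)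

module _ {p : ℕ → ℕ → Bool} (cp : CompRel p) where

  private
    c : Comp {2} (λ v → boolToℕ (not (p (lookup v zero) (lookup v (suc zero)))))
    c = CompB.toComp (notᶜ (toCompB cp))

  -- For `p` the relation `between`, the number found is no mere stage but the separating label
  -- itself.
  first : PR 1
  first = mu (Comp.code c)

  first-sound : ∀ {n s} → first ⟨ n ⟩≃ s → p s n ≡ true
  first-sound {n} {s} run with p s n | mu-sound c (n ∷ []) run
  ... | true | _ = refl

  first-complete : ∀ {n} s → p s n ≡ true → ∃ λ s′ → first ⟨ n ⟩≃ s′ × p s′ n ≡ true
  first-complete {n} s ps =
    let s′ , run = mu-complete c (n ∷ []) s (cong (λ b → boolToℕ (not b)) ps)
    in s′ , run , first-sound run

module Power (C : ℕ → Set) (C-infinite : Infinite C)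
  (out : ℕ → ℕ → Bool) (outᶜ : CompRel out)
  (out-mono : ∀ {s s′ n} → s ≤ s′ → out s n ≡ true → out s′ n ≡ true)
  (C⇒D : ∀ {n} → C n → Never out n)
  (D⇒¬¬C : ∀ {n} → Never out n → ¬ ¬ C n)
  (lpo : LPO)
  (D-dichotomy : Dichotomy (Never out))
  where

  D-infinite : Infinite (Never out)
  D-infinite m = let n , m≤n , cn = C-infinite m in n , m≤n , C⇒D cn

  open Sparsity out outᶜ out-mono lpo D-infinite D-dichotomy

  -- Members of `D` are in `C` only up to double negation, which suffices for Boolean facts.
  D-stable : ∀ {n b} → Never out n → (C n → b ≡ true) → b ≡ true
  D-stable {b = true}  dn imp = refl
  D-stable {b = false} dn imp = ⊥-elim (D⇒¬¬C dn λ cn → contradiction (imp cn) λ ())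

  -- Totality: on input n, wait until φ halts or n leaves C.
  totalise : ∀ φ → InPower C φ → ∃ λ f → Comp₁ f × (C ⊆* λ n → φ ⟨ n ⟩≃ f n)
  totalise φ (n₀ , dom) = f , mkComp₁ fᶜ , n₀ , correct
    where
    stop : ℕ → ℕ → Bool
    -- The first disjunct covers the inputs below `n₀`, where `φ` may diverge even on members of
    -- `C`.
    stop s n = (n <ᵇ n₀) ∨ halted φ s n ∨ out s n

    stopᶜ : CompRel stop
    stopᶜ = mkCompRel (x₁ <ᶜ constᶜ n₀ ∨ᶜ toCompB (haltedᶜ φ) ∨ᶜ toCompB outᶜ)

    ∨-trueʳ : ∀ a {b} → b ≡ true → a ∨ b ≡ true
    ∨-trueʳ false eq = eq
    ∨-trueʳ true eq = refl

    ∨-trueˡ : ∀ {a b} → a ≡ true → a ∨ b ≡ true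
    ∨-trueˡ refl = refl

    stops : ∀ n → ∃ λ s → stop s n ≡ true
    stops n with n <? n₀ | D? n | lpo {λ s → halted φ s n} (on₂ (haltedᶜ φ) x₀ (constᶜ n))
    ... | yes n<n₀ | _ | _ = 0 , ∨-trueˡ (<ᵇ-true n<n₀)
    ... | no _ | inj₁ (s , o) | _ = s , ∨-trueʳ (n <ᵇ n₀) (∨-trueʳ (halted φ s n) o)
    ... | no _ | inj₂ _ | inj₁ (s , h) = s , ∨-trueʳ (n <ᵇ n₀) (∨-trueˡ h)
    ... | no n≮n₀ | inj₂ dn | inj₂ never = ⊥-elim (D⇒¬¬C dn λ cn →
      let s , h = ↓⇒halted φ (dom n (≮⇒≥ n≮n₀) cn) in contradiction (trans (sym h) (never s)) λ ())

    minimal : ∃ λ (g : Vec ℕ 1 → ℕ) → Comp g ×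
      (∀ v → boolToℕ (not (stop (g v) (lookup v zero))) ≡ 0)
    minimal = minimiseᶜ (CompB.toComp (notᶜ (toCompB stopᶜ))) λ { (n ∷ []) →
      let s , eq = stops n in s , cong (λ b → boolToℕ (not b)) eq }

    f : ℕ → ℕ
    -- The default value is 0 if the wait ended without `φ` having halted.
    f n = pred (encode (eval (proj₁ minimal (n ∷ [])) φ (n ∷ [])))

    fᶜ : Comp {1} (λ v → f (lookup v zero))
    fᶜ = ext (predᶜ (clock φ ∘ᶜ (proj₁ (proj₂ minimal) ∷ᶜ idᶜ))) λ { (n ∷ []) → refl }

    correct : ∀ n → n₀ ≤ n → C n → φ ⟨ n ⟩≃ f n
    correct n n₀≤n cn = halted⇒≃ φ s n (lem (<ᵇ-false n₀≤n) (C⇒D cn s) (proj₂ (proj₂ minimal) (n ∷ [])))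
      where
      s = proj₁ minimal (n ∷ [])
      lem : ∀ {a b c} → a ≡ false → c ≡ false → boolToℕ (not (a ∨ b ∨ c)) ≡ 0 → b ≡ true
      lem {b = true} refl refl _ = refl

  -- Induction on the bound: by the dichotomy for `f n ≡ᵇ M`, either `φ` is almost constantly `M` on
  -- `C`, hence standard, or `f` avoids `M` from some point on.
  nonStandard-diverges : ∀ {φ f} → Comp₁ f → (C ⊆* λ n → φ ⟨ n ⟩≃ f n) → NonStandard C φ → Diverges f
  nonStandard-diverges cf φ≃f ns zero = 0 , λ n _ _ → z≤n
  nonStandard-diverges {φ} {f} cf (n₀ , φ≃f) ns (suc M) =
    let m , ev = nonStandard-diverges cf (n₀ , φ≃f) ns M ∩ avoids
    in m , λ n m≤n dn → let M≤fn , fn≢M = ev n m≤n dn in ≤∧≢⇒< M≤fn λ M≡fn → fn≢M (sym M≡fn)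
    where
    avoids : D ⊆* λ n → f n ≢ M
    avoids with D-dichotomy {λ s n → f n ≡ᵇ M} (mkCompRel (cf · x₁ ≡ᶜ constᶜ M))
    ... | inj₁ (m , always) = ⊥-elim (ns (M , m ⊔ n₀ , λ n le cn →
      subst (φ ⟨ n ⟩≃_) (≡ᵇ-true⁻¹ (proj₂ (always n (m⊔n≤o⇒m≤o m n₀ le) (C⇒D cn))))
        (φ≃f n (m⊔n≤o⇒n≤o m n₀ le) cn)))
    ... | inj₂ (m , never) = m , λ n m≤n dn fn≡M → contradiction
      (trans (sym (trans (cong (_≡ᵇ M) fn≡M) (≡ᵇ-true M))) (never n m≤n dn 0)) λ ()

  module _ {φ ψ : PR 1} {f g : ℕ → ℕ} (cf : Comp₁ f) (cg : Comp₁ g)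
    (φ≃f : C ⊆* λ n → φ ⟨ n ⟩≃ f n) (ψ≃g : C ⊆* λ n → ψ ⟨ n ⟩≃ g n)
    (f-div : Diverges f) (ψ<φ : LessC C lt ψ φ) where

    g≺f : D ⊆* λ n → g n ≺ f n
    g≺f = proj₁ ψ<φ ⊔ (proj₁ φ≃f ⊔ proj₁ ψ≃g) , λ n le dn → lt⇒≺ (D-stable dn λ cn →
      let le′ = m⊔n≤o⇒n≤o (proj₁ ψ<φ) _ le
          a , b , ψ≃a , φ≃b , a<b = proj₂ ψ<φ n (m⊔n≤o⇒m≤o (proj₁ ψ<φ) _ le) cn
      in trans (cong₂ lt (⟦⟧-functional ψ (proj₂ ψ≃g n (m⊔n≤o⇒n≤o (proj₁ φ≃f) _ le′) cn) ψ≃a)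
                         (⟦⟧-functional φ (proj₂ φ≃f n (m⊔n≤o⇒m≤o (proj₁ φ≃f) _ le′) cn) φ≃b)) a<b)

    module _ {e : ℕ → ℕ} (ce : Comp₁ e) {t₀} (e≤ : ∀ n → t₀ ≤ root (f n) → e n ≤ root (f n)) where

      θ : PR 1
      θ = first (betweenᶜ f g e cf cg ce)

      θ-between : C ⊆* λ n → ∃ λ z → φ ⟨ n ⟩≃ f n × ψ ⟨ n ⟩≃ g n × θ ⟨ n ⟩≃ z ×
        Between f g e n z
      θ-between =
        let m , ev = eventually-between cf cg ce f-div e≤ g≺f
        in m ⊔ (proj₁ φ≃f ⊔ proj₁ ψ≃g) , λ n le cn →
          let le′ = m⊔n≤o⇒n≤o m _ le
              z , bz = ev n (m⊔n≤o⇒m≤o m _ le) (C⇒D cn)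
              z′ , run , bz′ = first-complete (betweenᶜ f g e cf cg ce) z bz
          in z′ , proj₂ φ≃f n (m⊔n≤o⇒m≤o (proj₁ φ≃f) _ le′) cn ,
             proj₂ ψ≃g n (m⊔n≤o⇒n≤o (proj₁ φ≃f) _ le′) cn , run ,
             between⇒Between f g e z′ n bz′

      θ-inPower : InPower C θ
      θ-inPower = let m , ev = θ-between in m , λ n m≤n cn → let z , _ , _ , run , _ = ev n m≤n cn in z , run

      ψ<θ : LessC C lt ψ θ
      ψ<θ = let m , ev = θ-between in m , λ n m≤n cn →
        let z , _ , ψ≃ , θ≃ , gz , _ = ev n m≤n cn in g n , z , ψ≃ , θ≃ , ≺⇒lt {g n} {z} gz

      θ<φ : LessC C lt θ φ
      θ<φ = let m , ev = θ-between in m , λ n m≤n cn →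
        let z , φ≃ , _ , θ≃ , _ , zf , _ = ev n m≤n cn in z , f n , θ≃ , φ≃ , ≺⇒lt {z} {f n} zf

      θ-color : ∀ {δ} → (C ⊆* λ n → δ ⟨ n ⟩≃ e n) → ColorOf C color θ δ
      θ-color {δ} (m′ , δ≃e) = let m , ev = θ-between in m ⊔ m′ , λ n le cn →
        let z , _ , _ , θ≃ , _ , _ , cz = ev n (m⊔n≤o⇒m≤o m m′ le) cn
        in z , θ≃ , subst (δ ⟨ n ⟩≃_) (sym cz) (δ≃e n (m⊔n≤o⇒n≤o m m′ le) cn)

    solid : ∀ δ → Solid C δ → ∃ λ θ → InPower C θ × LessC C lt ψ θ × LessC C lt θ φ × ColorOf C color θ δ
    solid δ (c , δ≃c) = θ ce e≤ , θ-inPower ce e≤ , ψ<θ ce e≤ , θ<φ ce e≤ , θ-color ce e≤ δ≃c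
      where
      ce : Comp₁ (λ _ → c)
      ce = mkComp₁ (constᶜ c)
      -- The threshold `t₀` is `c` itself, as the blocks from `c` on permit the color `c`.
      e≤ : ∀ n → c ≤ root (f n) → c ≤ root (f n)
      e≤ n c≤ = c≤

    striped : ∃ λ θ → InPower C θ × LessC C lt ψ θ × LessC C lt θ φ ×
      ∃ λ δ → IsColor C δ × ColorOf C color θ δ × Striped C δ
    striped = θ ce e≤ , θ-inPower ce e≤ , ψ<θ ce e≤ , θ<φ ce e≤ ,
      δ , (0 , λ n _ _ → root (f n) , δ≃ n) , θ-color ce e≤ (0 , λ n _ _ → δ≃ n) , not-solid
      where
      ce : Comp₁ (λ n → root (f n))
      ce = mkComp₁ (rootᶜ (cf · x₀))
      e≤ : ∀ n → 0 ≤ root (f n) → root (f n) ≤ root (f n)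
      e≤ n _ = ≤-refl
      δ : PR 1
      δ = Comp.code (toComp₁ ce)
      δ≃ : ∀ n → δ ⟨ n ⟩≃ root (f n)
      δ≃ n = Comp.runs (toComp₁ ce) (n ∷ [])
      -- A constant color `c` would keep almost all values of `f` on `C` inside the finite block
      -- `c`, against divergence.
      not-solid : Striped C δ
      not-solid (c , m , δ≃c) =
        let β , finite = blocks-finite (suc c)
            m′ , large = f-div β
            n , le , cn = C-infinite (m ⊔ m′)
        in <⇒≱ (finite (f n) (s≤s (≤-reflexive (⟦⟧-functional δ (δ≃ n) (δ≃c n (m⊔n≤o⇒m≤o m m′ le) cn)))))
             (large n (m⊔n≤o⇒n≤o m m′ le) (C⇒D cn))

  coloredCopy : Σ (ℕ → ℕ → Bool) λ lt → Computable₂ lt × OmegaType lt ×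
    Σ (ℕ → ℕ) λ F → Computable F ×
    (∀ (φ ψ : PR 1) → InPower C φ → InPower C ψ →
      NonStandard C φ → NonStandard C ψ → LessC C lt ψ φ →
      (∀ (δ : PR 1) → IsColor C δ → Solid C δ →
        ∃ λ (θ : PR 1) → InPower C θ × LessC C lt ψ θ × LessC C lt θ φ ×
          ColorOf C F θ δ)
      × (∃ λ (θ : PR 1) → InPower C θ × LessC C lt ψ θ × LessC C lt θ φ ×
          ∃ λ (δ : PR 1) → IsColor C δ × ColorOf C F θ δ × Striped C δ))
  coloredCopy = lt , (Comp.code ltᶜ₂ , λ x y → Comp.runs ltᶜ₂ (x ∷ y ∷ [])) , lt-omegaType ,
    color , (Comp.code colorᶜ₁ , λ x → Comp.runs colorᶜ₁ (x ∷ [])) ,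
    λ φ ψ φ∈ ψ∈ φ-ns ψ-ns ψ<φ →
      let f , cf , φ≃f = totalise φ φ∈
          g , cg , ψ≃g = totalise ψ ψ∈
          f-div = nonStandard-diverges cf φ≃f φ-ns
      in (λ δ _ → solid cf cg φ≃f ψ≃g f-div ψ<φ δ) , striped cf cg φ≃f ψ≃g f-div ψ<φ
    where
    ltᶜ₂ : Comp {2} (λ v → boolToℕ (lt (lookup v zero) (lookup v (suc zero))))
    ltᶜ₂ = CompB.toComp (ltᶜ x₀ x₁)
    colorᶜ₁ : Comp {1} (λ v → color (lookup v zero))
    colorᶜ₁ = colorᶜ x₀

-- Omniscience and dichotomy from a co-c.e. cohesive set

module _ (C : ℕ → Set) (coce : CoCE C) (cohesive : Cohesive C) where

  C-dichotomy : Dichotomy C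
  C-dichotomy {p} cp with proj₂ cohesive (first cp)
  ... | inj₁ (m , yes′) = inj₁ (m , λ n m≤n cn → let s , run = yes′ n m≤n cn in s , first-sound cp run)
  ... | inj₂ (m , no′)  = inj₂ (m , λ n m≤n cn s → none n s (no′ n m≤n cn))
    where
    none : ∀ n s → ¬ W (first cp) n → p s n ≡ false
    none n s ¬w with p s n in ps
    ... | false = refl
    ... | true  = contradiction (let s′ , run , _ = first-complete cp s ps in s′ , run) ¬w

  -- Cohesiveness is applied to a predicate that ignores `n`, whose c.e. set is empty or everything;
  -- a large member of the infinite set `C` reveals which.
  lpo : LPO
  lpo {p} cp with C-dichotomy {λ s n → p s} (mkCompRel (cp ∘ᵇᶜ (x₀ ∷ᶜ []ᶜ)))
  ... | inj₁ (m , found) = let n , m≤n , cn = proj₁ cohesive m in inj₁ (found n m≤n cn)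
  ... | inj₂ (m , none)  = let n , m≤n , cn = proj₁ cohesive m in inj₂ (none n m≤n cn)

  out : ℕ → ℕ → Bool
  out = halted (proj₁ coce)

  C⇒D : ∀ {n} → C n → Never out n
  C⇒D {n} cn s with out s n in eq
  ... | false = refl
  ... | true  = contradiction cn (Equivalence.from (proj₂ coce n) (_ , halted⇒≃ (proj₁ coce) s n eq))

  D⇒¬¬C : ∀ {n} → Never out n → ¬ ¬ C n
  D⇒¬¬C {n} dn ¬cn =
    let s , o = ↓⇒halted (proj₁ coce) (Equivalence.to (proj₂ coce n) ¬cn)
    in contradiction (trans (sym o) (dn s)) λ ()

  -- The first alternative passes from `C` to `D` because `lpo` decides whether a stage exists, the
  -- second because each value of `p` is a Boolean; both are thus stable under double negation.
  D-dichotomy : Dichotomy (Never out)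
  D-dichotomy {p} cp with C-dichotomy cp
  ... | inj₁ (m , found) = inj₁ (m , λ n m≤n dn → decide n (found n m≤n) dn)
    where
    decide : ∀ n → (C n → ∃ λ s → p s n ≡ true) → Never out n → ∃ λ s → p s n ≡ true
    decide n found dn with lpo {λ s → p s n} (on₂ cp x₀ (constᶜ n))
    ... | inj₁ hit  = hit
    ... | inj₂ none = ⊥-elim (D⇒¬¬C dn λ cn →
      let s , ps = found cn in contradiction (trans (sym ps) (none s)) λ ())
  ... | inj₂ (m , none) = inj₂ (m , λ n m≤n dn s → ¬-not (λ ps →
    D⇒¬¬C dn λ cn → contradiction (trans (sym ps) (none n m≤n cn s)) λ ()))

theorem5p1 : (C : ℕ → Set) → CoCE C → Cohesive C →
    Σ (ℕ → ℕ → Bool) λ lt → Computable₂ lt × OmegaType lt ×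
    Σ (ℕ → ℕ) λ F → Computable F ×
    (∀ (φ ψ : PR 1) → InPower C φ → InPower C ψ →
    NonStandard C φ → NonStandard C ψ → LessC C lt ψ φ →
    (∀ (δ : PR 1) → IsColor C δ → Solid C δ →
    ∃ λ (θ : PR 1) → InPower C θ × LessC C lt ψ θ × LessC C lt θ φ ×
    ColorOf C F θ δ)
    × (∃ λ (θ : PR 1) → InPower C θ × LessC C lt ψ θ × LessC C lt θ φ ×
    ∃ λ (δ : PR 1) → IsColor C δ × ColorOf C F θ δ × Striped C δ))
theorem5p1 C coce cohesive = Power.coloredCopy C (proj₁ cohesive) (out C coce cohesive) (haltedᶜ (proj₁ coce))
  (halted-mono (proj₁ coce)) (C⇒D C coce cohesive) (D⇒¬¬C C coce cohesive) (lpo C coce cohesive)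
  (D-dichotomy C coce cohesive)
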